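{- Let $(\lambda,\mu)\models n$ be a component-type with $2\leq \ell(\lambda)< n-\ell(\mu)$. Then $$W^{\lambda,\mu}_{n-\ell(\mu)-1}\;\geq\;\tfrac12\,W^{\lambda,\mu}_{n-\ell(\mu)},$$ and the constant $1/2$ is best possible (there exist such $(\lambda,\mu)$ for which equality holds).
   Context: Let $A,B$ be finite sets with $|A|=|B|=n$. For a bijection $f:A\to B$ (or $B\to A$), let $G_f$ be the directed graph on $A\cup B$ with an edge $x\to y$ whenever $f(x)=y$. Each connected component of $G_f$ is either a directed cycle or a directed path; $|f|$ denotes the number of components of $G_f$. The size of a cycle is its number of elements; the size of a path is its number of elements minus one. The component-type of $f$ is the pair $(\lambda,\mu)$ where $\lambda$ is the non-increasing sequence of path sizes and $\mu$ the non-increasing sequence of cycle sizes; then $\sum_i\lambda_i+\sum_j\mu_j=n$, written $(\lambda,\mu)\models n$, and $\ell(\lambda)$, $\ell(\mu)$ denote the numbers of parts (the number of paths and of cycles, respectively). For a bijection $D:B\to A$ of component-type $(\lambda,\mu)$, define $W^{\lambda,\mu}_k$ as the number of cyclic permutations $s$ of $A$ (i.e. $n$-cycles on $A$) such that the bijection $f=D^{ -1}\circ s:A\to B$ satisfies $|f|=k$ (equivalently, the number of factorizations $D=s\circ f^{ -1}$ with $s$ an $n$-cycle on $A$ and $f:A\to B$ a bijection with $k$ components); this number depends only on $(\lambda,\mu)$ and $k$, not on the particular choice of $A$, $B$, $D$. -}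

module Defs where

open import Data.Bool using (Bool; true; false; _∧_; _∨_; not; if_then_else_)
open import Data.Nat using (ℕ; zero; suc; _∸_; _≡ᵇ_; _<ᵇ_)
open import Data.Fin using (Fin; toℕ; _≟_)
open import Data.Fin.Subset using (Subset; _∈_; _∪_)
open import Data.List using (List; []; _∷_; [_]; length; map; concatMap; allFin; upTo; filterᵇ)
open import Data.Bool.ListAction using (all; any)
open import Data.List.Relation.Binary.Permutation.Propositional using (_↭_)
open import Data.Vec using (Vec; lookup)
import Data.Vec as Vec
open import Data.Product using (_×_; ∃)
open import Relation.Binary.PropositionalEquality using (_≡_)
open import Relation.Nullary.Decidable using (⌊_⌋)

-- The finite sets A, B are subsets of a common ground set Fin N
-- (they may overlap).  A subset is a Vec Bool N, membership of x is
-- the Boolean  lookup S x.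

module _ {N : ℕ} where

  _==_ : Fin N → Fin N → Bool
  x == y = ⌊ x ≟ y ⌋

  count : {X : Set} → (X → Bool) → List X → ℕ
  count p xs = length (filterᵇ p xs)

  -- Directed graphs on the vertex set V ⊆ Fin N, given by a Boolean
  -- edge relation  E x y  ("x → y").

  Graph : Set
  Graph = Fin N → Fin N → Bool

  adj : Graph → Fin N → Fin N → Bool
  adj E x y = E x y ∨ E y x

  reach : Graph → ℕ → Fin N → Fin N → Bool
  reach E zero    x y = x == y
  reach E (suc k) x y = reach E k x y ∨ any (λ z → reach E k x z ∧ adj E z y) (allFin N)

  -- x and y lie in the same connected component (walks of length ≤ N suffice)
  connected : Graph → Fin N → Fin N → Bool
  connected E x y = reach E N x y

  -- x ∈ V is the least element (in Fin order) of its component;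
  -- components are in bijection with such representatives
  isRep : Subset N → Graph → Fin N → Bool
  isRep V E x = lookup V x ∧ not (any (λ y → lookup V y ∧ (toℕ y <ᵇ toℕ x) ∧ connected E x y) (allFin N))

  numComponents : Subset N → Graph → ℕ
  numComponents V E = count (isRep V E) (allFin N)

  componentOf : Subset N → Graph → Fin N → List (Fin N)
  componentOf V E x = filterᵇ (λ y → lookup V y ∧ connected E x y) (allFin N)

  hasOut : Graph → Fin N → Bool
  hasOut E y = any (E y) (allFin N)

  hasIn : Graph → Fin N → Bool
  hasIn E y = any (λ z → E z y) (allFin N)

  -- the component of x is a directed cycle: every vertex of it has an
  -- outgoing and an incoming edge (otherwise it is a directed path)
  isCycleComp : Subset N → Graph → Fin N → Bool
  isCycleComp V E x = all (λ y → hasOut E y ∧ hasIn E y) (componentOf V E x)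

  cycleSizes : Subset N → Graph → List ℕ
  cycleSizes V E = map (λ x → length (componentOf V E x))
                       (filterᵇ (λ x → isRep V E x ∧ isCycleComp V E x) (allFin N))

  pathSizes : Subset N → Graph → List ℕ
  pathSizes V E = map (λ x → length (componentOf V E x) ∸ 1)
                      (filterᵇ (λ x → isRep V E x ∧ not (isCycleComp V E x)) (allFin N))

  -- A bijection D : B → A, represented by a function d on the ground set
  -- (values outside B are irrelevant).

  IsBijection : (B A : Subset N) → (Fin N → Fin N) → Set
  IsBijection B A d =
      (∀ x → x ∈ B → d x ∈ A)
    × (∀ x y → x ∈ B → y ∈ B → d x ≡ d y → x ≡ y)
    × (∀ y → y ∈ A → ∃ λ x → x ∈ B × d x ≡ y)

  graphD : (B : Subset N) → (Fin N → Fin N) → Graph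
  graphD B d x y = lookup B x ∧ (d x == y)

  ComponentType : (A B : Subset N) → (Fin N → Fin N) → List ℕ → List ℕ → Set
  ComponentType A B d la mu =
    (pathSizes (A ∪ B) (graphD B d) ↭ la) × (cycleSizes (A ∪ B) (graphD B d) ↭ mu)

  -- G_f for f = D⁻¹ ∘ s : A → B : edge x → y iff x ∈ A, y ∈ B, f x = y,
  -- i.e. D y = s x
  graphF : (A B : Subset N) → (Fin N → Fin N) → (Fin N → Fin N) → Graph
  graphF A B d s x y = lookup A x ∧ lookup B y ∧ (d y == s x)

  -- Cyclic permutations of A, as functions on Fin N that are the identity
  -- outside A.

  iter : ℕ → (Fin N → Fin N) → Fin N → Fin N
  iter zero    s x = x
  iter (suc i) s x = s (iter i s x)

  isCyclicOn : Subset N → (Fin N → Fin N) → Bool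
  isCyclicOn A s =
        all (λ x → if lookup A x then lookup A (s x) else (s x == x)) (allFin N)
      ∧ all (λ x → all (λ y → not (lookup A x ∧ lookup A y ∧ (s x == s y)) ∨ (x == y)) (allFin N)) (allFin N)
      ∧ all (λ x → all (λ y → not (lookup A x ∧ lookup A y) ∨ any (λ i → iter i s x == y) (upTo N)) (allFin N)) (allFin N)

  allVecs : (k : ℕ) → List (Vec (Fin N) k)
  allVecs zero    = [ Vec.[] ]
  allVecs (suc k) = concatMap (λ x → map (x Vec.∷_) (allVecs k)) (allFin N)

  W : (A B : Subset N) → (Fin N → Fin N) → ℕ → ℕ
  W A B d k = count (λ v → isCyclicOn A (lookup v)
                           ∧ (numComponents (A ∪ B) (graphF A B d (lookup v)) ≡ᵇ k))
                    (allVecs N)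

{-# OPTIONS --safe #-}

-- Write f = D⁻¹ ∘ s.  The paths of f start at the elements of A ∖ B, a set that does not depend on s and
-- has ℓ(λ) ≥ 2 elements; fix two of them, b and b′.  Charging components of f and cycles of D to
-- elements of A, in the order in which s visits them, shows |f| ≤ n − ℓ(μ) for every cyclic s.
--
-- Let |f| = n − ℓ(μ).  Since |f| > ℓ(λ), f has a cycle.  Let a be the first element after b, in the
-- order of s, that lies on a cycle of f, and suppose that b′ comes later than a (otherwise exchange the
-- roles of b and b′; this choice is the factor 2).  Then s′ = s ∘ (a b′) ∘ (b b′) is again cyclic.
-- Composing f with (a b′) merges the cycle of a into the path of b′, and composing with (b b′) merely
-- renames two vertices without incoming edge, so |f′| = |f| − 1.
--
-- The map s ↦ s′ is injective.  If s₁ and s₂ have the same image and a₂ is visited before a₁, then a₂ is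
-- visited by s₁ strictly between b and b′ and lies on the path of b′ in f₁; exchanging as above with a₂ in
-- place of a₁ would then split that path and give |f| > n − ℓ(μ).
module Submission where

open import Defs
open import Data.Nat using (ℕ; zero; suc; _+_; _*_; _∸_; _≤_; _<_; _<?_; _≡ᵇ_; z≤n; s≤s; z<s)
import Data.Nat.Properties as ℕ
open import Data.Nat.Induction using (<-wellFounded)
open import Data.Bool using (Bool; true; false; T; not; _∧_; _∨_; if_then_else_)
open import Data.Bool.Properties using (T?; T-∧; T-∨; T-≡)
open import Data.Bool.ListAction using (any; all)
open import Data.Fin using (Fin; zero; suc; toℕ; _≟_; #_)
import Data.Fin.Properties as Fin
open import Data.Fin.Permutation.Components using (transpose)
open import Data.Fin.Subset using (Subset; ∣_∣; _∪_; inside; outside)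
import Data.Fin.Subset as Subset
open import Data.Fin.Subset.Properties using (x∈p∪q⁺; x∈p∪q⁻; _∈?_)
open import Data.List using (List; []; _∷_; _++_; length; map; filterᵇ; allFin; concatMap; upTo)
import Data.List.Properties as List
open import Data.List.Membership.Propositional using (_∈_; _∉_; find; lose)
open import Data.List.Membership.Propositional.Properties using (∈-∃++; ∈-++⁺ˡ; ∈-++⁺ʳ; ∈-++⁻; ∈-filter⁺; ∈-filter⁻; ∈-allFin; ∈-upTo⁺; ∈-map⁺; ∈-map⁻; ∈-concatMap⁺; ∈-concatMap⁻)
open import Data.List.Relation.Unary.Any using (here; there)
import Data.List.Relation.Unary.Any.Properties as Any
open import Data.List.Relation.Unary.All using ([]; _∷_)
import Data.List.Relation.Unary.All as All
import Data.List.Relation.Unary.All.Properties as All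
open import Data.List.Relation.Unary.Unique.Propositional using (Unique; []; _∷_)
import Data.List.Relation.Unary.Unique.Propositional.Properties as Unique
open import Data.List.Relation.Binary.Permutation.Propositional using (↭-refl)
open import Data.List.Relation.Binary.Permutation.Propositional.Properties using (↭-length)
open import Data.Maybe using (Maybe; just; nothing)
open import Data.Maybe.Properties using (just-injective)
open import Data.Vec using (Vec; []; _∷_; lookup; tabulate)
import Data.Vec.Properties as Vec
open import Data.Product using (_×_; _,_; ∃; Σ; proj₁; proj₂)
open import Data.Sum using (_⊎_; inj₁; inj₂)
open import Data.Sum.Properties using (inj₁-injective; inj₂-injective)
open import Data.Empty using (⊥; ⊥-elim)
open import Function using (_∘_; id)
open import Function.Bundles using (Equivalence)
open import Induction.WellFounded using (Acc; acc)
open import Relation.Nullary using (¬_; Dec; yes; no; contradiction)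
open import Relation.Nullary.Decidable using (toWitness; fromWitness; map′; ¬?; _×-dec_; _→-dec_; from-yes)
open import Relation.Unary using (Decidable)
open import Relation.Binary using (tri<; tri≈; tri>)
open import Relation.Binary.PropositionalEquality
open import Relation.Binary.Construct.Closure.ReflexiveTransitive using (ε; _◅_; _◅◅_)
open import Relation.Binary.Construct.Closure.Symmetric using (SymClosure; fwd; bwd)
open import Relation.Binary.Construct.Closure.Equivalence as EqC using (EqClosure)

-- Comparing lengths of lists through injective relations.

relation⇒length≤ : {X Y : Set} (R : X → Y → Set) {xs : List X} {ys : List Y} → Unique xs
  → (∀ {x} → x ∈ xs → ∃ λ y → y ∈ ys × R x y)
  → (∀ {x x′ y} → x ∈ xs → x′ ∈ xs → R x y → R x′ y → x ≡ x′)
  → length xs ≤ length ys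
relation⇒length≤ R [] total inj = z≤n
relation⇒length≤ R {x ∷ xs} (x∉ ∷ uniq) total inj with total (here refl)
... | y , y∈ys , Rxy with ∈-∃++ y∈ys
...   | as , bs , refl = subst (suc (length xs) ≤_) (sym len)
          (s≤s (relation⇒length≤ R uniq total′ (λ p q → inj (there p) (there q))))
  where
  len : length (as ++ y ∷ bs) ≡ suc (length (as ++ bs))
  len = trans (List.length-++ as) (trans (ℕ.+-suc _ _) (cong suc (sym (List.length-++ as))))
  total′ : ∀ {x′} → x′ ∈ xs → ∃ λ y′ → y′ ∈ as ++ bs × R x′ y′
  total′ x′∈ with total (there x′∈)
  ... | y′ , y′∈ , Rx′y′ with ∈-++⁻ as y′∈
  ...   | inj₁ p = y′ , ∈-++⁺ˡ p , Rx′y′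
  ...   | inj₂ (there p) = y′ , ∈-++⁺ʳ as p , Rx′y′
  -- `y` is already the partner of `x`, so by injectivity no later element can claim it.
  ...   | inj₂ (here refl) = contradiction (inj (here refl) (there x′∈) Rxy Rx′y′) (All.lookup x∉ x′∈)

⊆⇒length≤ : {X : Set} {xs ys : List X} → Unique xs → (∀ {x} → x ∈ xs → x ∈ ys) → length xs ≤ length ys
⊆⇒length≤ uniq sub = relation⇒length≤ _≡_ uniq (λ p → _ , sub p , refl) (λ { _ _ refl refl → refl })

unique-∷ : {X : Set} {x : X} {xs : List X} → x ∉ xs → Unique xs → Unique (x ∷ xs)
unique-∷ x∉ uniq = All.¬Any⇒All¬ _ x∉ ∷ uniq

-- Boolean tests as propositions.

∧⁺ : ∀ {x y} → T x → T y → T (x ∧ y)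
∧⁺ p q = Equivalence.from T-∧ (p , q)

∧⁻ : ∀ {x y} → T (x ∧ y) → T x × T y
∧⁻ = Equivalence.to T-∧

∨⁺ : ∀ {x y} → T x ⊎ T y → T (x ∨ y)
∨⁺ = Equivalence.from T-∨

∨⁻ : ∀ {x y} → T (x ∨ y) → T x ⊎ T y
∨⁻ = Equivalence.to T-∨

not⁺ : ∀ {x} → ¬ T x → T (not x)
not⁺ {true}  ¬p = ¬p _
not⁺ {false} ¬p = _

not⁻ : ∀ {x} → T (not x) → ¬ T x
not⁻ {false} _ ()

module _ {N : ℕ} where

  anyFin⁺ : (p : Fin N → Bool) (x : Fin N) → T (p x) → T (any p (allFin N))
  anyFin⁺ p x px = Any.any⁺ p (lose (∈-allFin x) px)

  anyFin⁻ : (p : Fin N → Bool) → T (any p (allFin N)) → ∃ λ x → T (p x)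
  anyFin⁻ p h with find (Any.any⁻ p (allFin N) h)
  ... | x , _ , px = x , px

  allFin⁺ : (p : Fin N → Bool) → (∀ x → T (p x)) → T (all p (allFin N))
  allFin⁺ p h = All.all⁻ p {xs = allFin N} (All.tabulate (λ {x} _ → h x))

  allFin⁻ : (p : Fin N → Bool) → T (all p (allFin N)) → ∀ x → T (p x)
  allFin⁻ p h x = All.lookup (All.all⁺ p (allFin N) h) (∈-allFin x)

  ∈-filterFin⁺ : {p : Fin N → Bool} {x : Fin N} → T (p x) → x ∈ filterᵇ p (allFin N)
  ∈-filterFin⁺ {p} px = ∈-filter⁺ (T? ∘ p) (∈-allFin _) px

  ∈-filterFin⁻ : {p : Fin N → Bool} {x : Fin N} → x ∈ filterᵇ p (allFin N) → T (p x)
  ∈-filterFin⁻ {p} x∈ = proj₂ (∈-filter⁻ (T? ∘ p) {xs = allFin N} x∈)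

  filterFin-unique : (p : Fin N → Bool) → Unique (filterᵇ p (allFin N))
  filterFin-unique p = Unique.filter⁺ (T? ∘ p) (Unique.allFin⁺ N)

  -- Connectivity and the number of components.

  Conn : Graph {N} → Fin N → Fin N → Set
  Conn E = EqClosure (λ x y → T (E x y))

  module _ (E : Graph {N}) where

    adj⇒sym : ∀ {x y} → T (adj E x y) → SymClosure (λ x y → T (E x y)) x y
    adj⇒sym a with ∨⁻ a
    ... | inj₁ e = fwd e
    ... | inj₂ e = bwd e

    sym⇒adj : ∀ {x y} → SymClosure (λ x y → T (E x y)) x y → T (adj E x y)
    sym⇒adj (fwd e) = ∨⁺ (inj₁ e)
    sym⇒adj (bwd e) = ∨⁺ (inj₂ e)

    reach-suc⁻ : ∀ k {x y} → T (reach E (suc k) x y) → T (reach E k x y) ⊎ (∃ λ z → T (reach E k x z) × T (adj E z y))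
    reach-suc⁻ k r with ∨⁻ r
    ... | inj₁ p = inj₁ p
    ... | inj₂ p = let z , q = anyFin⁻ _ p in inj₂ (z , ∧⁻ q)

    reach-suc⁺ : ∀ k {x z y} → T (reach E k x z) → T (adj E z y) → T (reach E (suc k) x y)
    reach-suc⁺ k {z = z} r a = ∨⁺ (inj₂ (anyFin⁺ _ z (∧⁺ r a)))

    reach-refl : ∀ k x → T (reach E k x x)
    reach-refl zero    x = fromWitness refl
    reach-refl (suc k) x = ∨⁺ (inj₁ (reach-refl k x))

    reach⇒Conn : ∀ k {x y} → T (reach E k x y) → Conn E x y
    reach⇒Conn zero r with toWitness r
    ... | refl = ε
    reach⇒Conn (suc k) r with reach-suc⁻ k r
    ... | inj₁ p = reach⇒Conn k p
    ... | inj₂ (z , p , a) = reach⇒Conn k p ◅◅ (adj⇒sym a ◅ ε)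

    ReachClosed : Fin N → ℕ → Set
    ReachClosed x k = ∀ {z y} → T (reach E k x z) → T (adj E z y) → T (reach E k x y)

    ball : Fin N → ℕ → List (Fin N)
    ball x k = filterᵇ (reach E k x) (allFin N)

    -- As long as the ball of radius k is not closed it gains a vertex at each step.
    closed-or-large : ∀ x k → ReachClosed x k ⊎ (suc k ≤ length (ball x k))
    closed-or-large x zero = inj₂ (⊆⇒length≤ ([] ∷ []) λ { (here refl) → ∈-filterFin⁺ (reach-refl 0 x) })
    closed-or-large x (suc k) with closed-or-large x k
    ... | inj₁ closed = inj₁ λ r a → ∨⁺ (inj₁ (closed (back r) a))
      where
      back : ∀ {z} → T (reach E (suc k) x z) → T (reach E k x z)
      back r with reach-suc⁻ k r
      ... | inj₁ p = p
      ... | inj₂ (_ , p , a) = closed p a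
    ... | inj₂ large with Fin.any? (λ y → T? (reach E (suc k) x y) ×-dec ¬? (T? (reach E k x y)))
    ...   | yes (y , new , old) = inj₂ (ℕ.≤-trans (s≤s large)
            (⊆⇒length≤ (unique-∷ (old ∘ ∈-filterFin⁻) (filterFin-unique _)) sub))
      where
      sub : ∀ {z} → z ∈ y ∷ ball x k → z ∈ ball x (suc k)
      sub (here refl) = ∈-filterFin⁺ new
      sub (there z∈)  = ∈-filterFin⁺ (∨⁺ (inj₁ (∈-filterFin⁻ z∈)))
    ...   | no none = inj₁ λ r a → ∨⁺ (inj₁ (stay (reach-suc⁺ k (stay r) a)))
      where
      stay : ∀ {z} → T (reach E (suc k) x z) → T (reach E k x z)
      stay {z} r with T? (reach E k x z)
      ... | yes p = p
      ... | no ¬p = ⊥-elim (none (z , r , ¬p))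

    -- A ball still growing at radius `N` would contain more than `N` vertices. Hence the `N` rounds
    -- made by `connected` find the whole component.
    reach-closed : ∀ x → ReachClosed x N
    reach-closed x with closed-or-large x N
    ... | inj₁ closed = closed
    ... | inj₂ large  = ⊥-elim (ℕ.<-irrefl refl (ℕ.≤-trans large
            (subst (length (ball x N) ≤_) (List.length-tabulate {n = N} id) (List.length-filter (T? ∘ reach E N x) (allFin N)))))

    connected⇒Conn : ∀ {x y} → T (connected E x y) → Conn E x y
    connected⇒Conn = reach⇒Conn N

    Conn⇒connected : ∀ {x y} → Conn E x y → T (connected E x y)
    Conn⇒connected {x} = go (reach-refl N x)
      where
      go : ∀ {z y} → T (reach E N x z) → Conn E z y → T (reach E N x y)
      go r ε = r
      go r (e ◅ es) = go (reach-closed x r (sym⇒adj e)) es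

    Conn? : ∀ x y → Dec (Conn E x y)
    Conn? x y = map′ connected⇒Conn Conn⇒connected (T? (connected E x y))

    ~sym : ∀ {x y} → Conn E x y → Conn E y x
    ~sym = EqC.symmetric _

    module _ (V : Subset N) where

      rep-unique : ∀ {r r′} → T (isRep V E r) → T (isRep V E r′) → Conn E r r′ → r ≡ r′
      rep-unique {r} {r′} p p′ c with ∧⁻ p | ∧⁻ p′
      ... | r∈ , min | r′∈ , min′ with ℕ.<-cmp (toℕ r) (toℕ r′)
      ...   | tri< lt _ _ = ⊥-elim (not⁻ min′ (anyFin⁺ _ r (∧⁺ r∈ (∧⁺ (ℕ.<⇒<ᵇ lt) (Conn⇒connected (~sym c))))))
      ...   | tri≈ _ eq _ = Fin.toℕ-injective eq
      ...   | tri> _ _ gt = ⊥-elim (not⁻ min (anyFin⁺ _ r′ (∧⁺ r′∈ (∧⁺ (ℕ.<⇒<ᵇ gt) (Conn⇒connected c)))))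

      rep-exists : ∀ x → T (lookup V x) → ∃ λ r → T (isRep V E r) × Conn E x r
      rep-exists x = go x (<-wellFounded (toℕ x))
        where
        go : ∀ x → Acc _<_ (toℕ x) → T (lookup V x) → ∃ λ r → T (isRep V E r) × Conn E x r
        go x (acc rec) x∈ with T? (isRep V E x)
        ... | yes p = x , p , ε
        ... | no ¬p with T? (any _ (allFin N))
        ...   | no ¬q = ⊥-elim (¬p (∧⁺ x∈ (not⁺ ¬q)))
        ...   | yes q with anyFin⁻ _ q
        ...     | y , h with ∧⁻ h
        ...       | y∈ , h′ with ∧⁻ h′
        ...         | lt , c with go y (rec (ℕ.<ᵇ⇒< _ _ lt)) y∈
        ...           | r , r-rep , y~r = r , r-rep , connected⇒Conn c ◅◅ y~r

      reps : List (Fin N)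
      reps = filterᵇ (isRep V E) (allFin N)

      -- Representatives of distinct components are never connected, so no two of them share a value
      -- under `R`. Callers can argue about arbitrary vertices of `V` without mentioning
      -- representatives.
      numComponents-≤ : {Y : Set} {ys : List Y} (R : Fin N → Y → Set)
        → (∀ x → T (lookup V x) → ∃ λ y → y ∈ ys × R x y)
        → (∀ {x x′ y} → R x y → R x′ y → Conn E x x′)
        → numComponents V E ≤ length ys
      numComponents-≤ R total inj = relation⇒length≤ R {xs = reps} (filterFin-unique _)
        (λ {x} x∈ → total x (proj₁ (∧⁻ (∈-filterFin⁻ x∈))))
        (λ p q r r′ → rep-unique (∈-filterFin⁻ p) (∈-filterFin⁻ q) (inj r r′))

-- Transpositions.

module _ {N : ℕ} where

  transpose-cases : (x y u : Fin N) → (u ≡ x × transpose x y u ≡ y)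
                  ⊎ (u ≡ y × transpose x y u ≡ x) ⊎ (u ≢ x × u ≢ y × transpose x y u ≡ u)
  transpose-cases x y u with u ≟ x
  ... | yes u≡x = inj₁ (u≡x , refl)
  ... | no u≢x with u ≟ y
  ...   | yes u≡y = inj₂ (inj₁ (u≡y , refl))
  ...   | no u≢y  = inj₂ (inj₂ (u≢x , u≢y , refl))

  transpose-left : (x y : Fin N) → transpose x y x ≡ y
  transpose-left x y with transpose-cases x y x
  ... | inj₁ (_ , eq) = eq
  ... | inj₂ (inj₁ (x≡y , eq)) = trans eq x≡y
  ... | inj₂ (inj₂ (x≢x , _)) = ⊥-elim (x≢x refl)

  transpose-right : (x y : Fin N) → transpose x y y ≡ x
  transpose-right x y with transpose-cases x y y
  ... | inj₁ (y≡x , eq) = trans eq y≡x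
  ... | inj₂ (inj₁ (_ , eq)) = eq
  ... | inj₂ (inj₂ (_ , y≢y , _)) = ⊥-elim (y≢y refl)

  transpose-other : ∀ {x y u : Fin N} → u ≢ x → u ≢ y → transpose x y u ≡ u
  transpose-other {x} {y} {u} u≢x u≢y with transpose-cases x y u
  ... | inj₁ (u≡x , _) = ⊥-elim (u≢x u≡x)
  ... | inj₂ (inj₁ (u≡y , _)) = ⊥-elim (u≢y u≡y)
  ... | inj₂ (inj₂ (_ , _ , eq)) = eq

  transpose-involutive : (x y u : Fin N) → transpose x y (transpose x y u) ≡ u
  transpose-involutive x y u with transpose-cases x y u
  ... | inj₁ (u≡x , eq) = trans (cong (transpose x y) eq) (trans (transpose-right x y) (sym u≡x))
  ... | inj₂ (inj₁ (u≡y , eq)) = trans (cong (transpose x y) eq) (trans (transpose-left x y) (sym u≡y))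
  ... | inj₂ (inj₂ (_ , _ , eq)) = trans (cong (transpose x y) eq) eq

  transpose-injective : ∀ (x y : Fin N) {u v} → transpose x y u ≡ transpose x y v → u ≡ v
  transpose-injective x y {u} {v} eq = trans (sym (transpose-involutive x y u))
    (trans (cong (transpose x y) eq) (transpose-involutive x y v))

  transpose-preserves : (P : Fin N → Set) {x y : Fin N} → P x → P y → ∀ {u} → P u → P (transpose x y u)
  transpose-preserves P {x} {y} px py {u} pu with transpose-cases x y u
  ... | inj₁ (_ , eq) = subst P (sym eq) py
  ... | inj₂ (inj₁ (_ , eq)) = subst P (sym eq) px
  ... | inj₂ (inj₂ (_ , _ , eq)) = subst P (sym eq) pu

  -- Directed walks in graphs of partial injections.

  data Walk⁺ (E : Graph {N}) (x : Fin N) : Fin N → Set where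
    [_] : ∀ {z} → T (E x z) → Walk⁺ E x z
    _▷_ : ∀ {y z} → Walk⁺ E x y → T (E y z) → Walk⁺ E x z

  _++⁺_ : ∀ {E x y z} → Walk⁺ E x y → Walk⁺ E y z → Walk⁺ E x z
  p ++⁺ [ e ]   = p ▷ e
  p ++⁺ (q ▷ e) = (p ++⁺ q) ▷ e

  Walk⁺⇒Conn : ∀ {E x z} → Walk⁺ E x z → Conn E x z
  Walk⁺⇒Conn [ e ]   = fwd e ◅ ε
  Walk⁺⇒Conn (p ▷ e) = Walk⁺⇒Conn p ◅◅ (fwd e ◅ ε)

  last-edge : ∀ {E x z} → Walk⁺ E x z → ∃ λ u → T (E u z)
  last-edge [ e ]   = _ , e
  last-edge (p ▷ e) = _ , e

  -- The components of such a graph are directed paths and directed cycles, and `x` lies on a cycle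
  -- exactly when there is a `Walk⁺ E x x`.
  record PartialInjection (E : Graph {N}) : Set where
    field
      functional : ∀ {u w w′} → T (E u w) → T (E u w′) → w ≡ w′
      injective  : ∀ {u u′ w} → T (E u w) → T (E u′ w) → u ≡ u′

  NoIn : Graph {N} → Fin N → Set
  NoIn E b = ∀ {u} → ¬ T (E u b)

  module _ {E : Graph {N}} (pinj : PartialInjection E) where
    open PartialInjection pinj

    -- By injectivity a backward step can only retrace the last edge of the walk, and `NoIn` forbids
    -- stepping back behind `b`.
    start-component : ∀ {b x} → NoIn E b → Conn E b x → b ≡ x ⊎ Walk⁺ E b x
    start-component {b} noIn = go (inj₁ refl)
      where
      go : ∀ {z x} → b ≡ z ⊎ Walk⁺ E b z → Conn E z x → b ≡ x ⊎ Walk⁺ E b x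
      go p ε = p
      go (inj₁ refl)    (fwd e ◅ es) = go (inj₂ [ e ]) es
      go (inj₂ p)       (fwd e ◅ es) = go (inj₂ (p ▷ e)) es
      go (inj₁ refl)    (bwd e ◅ es) = ⊥-elim (noIn e)
      go (inj₂ [ e′ ])  (bwd e ◅ es) = go (inj₁ (injective e′ e)) es
      go (inj₂ (p ▷ e′)) (bwd e ◅ es) with injective e′ e
      ... | refl = go (inj₂ p) es

    -- Backward steps retrace the walk as in `start-component`. When they lead back to `x` itself,
    -- the full cycle `cyc` is taken as the new walk, which therefore never becomes empty.
    cycle-component : ∀ {x z} → Walk⁺ E x x → Conn E x z → Walk⁺ E x z
    cycle-component {x} cyc = go cyc
      where
      go : ∀ {y z} → Walk⁺ E x y → Conn E y z → Walk⁺ E x z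
      go p ε = p
      go p (fwd e ◅ es) = go (p ▷ e) es
      go [ e′ ] (bwd e ◅ es) with injective e′ e
      ... | refl = go cyc es
      go (p ▷ e′) (bwd e ◅ es) with injective e′ e
      ... | refl = go p es

    start-unique : ∀ {b b′} → NoIn E b → NoIn E b′ → Conn E b b′ → b ≡ b′
    start-unique noIn noIn′ c with start-component noIn c
    ... | inj₁ eq = eq
    ... | inj₂ p  = ⊥-elim (noIn′ (proj₂ (last-edge p)))

    -- Predecessors can be taken forever, so they repeat; functionality moves the repetition to x.
    no-start⇒cycle : ∀ {x} → (∀ z → Conn E x z → ∃ λ u → T (E u z)) → Walk⁺ E x x
    no-start⇒cycle {x} hasPred =
        let i , j , i<j , eq = Fin.pigeonhole (ℕ.n<1+n N) (λ i → proj₁ (back (toℕ i)))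
        in go (toℕ i) (toℕ j) i<j eq
      where
      back : ℕ → ∃ (Conn E x)
      back zero = x , ε
      back (suc k) = let z , c = back k ; u , e = hasPred z c in u , c ◅◅ (bwd e ◅ ε)
      edge : ∀ k → T (E (proj₁ (back (suc k))) (proj₁ (back k)))
      edge k = proj₂ (hasPred (proj₁ (back k)) (proj₂ (back k)))
      descend : ∀ k → Walk⁺ E (proj₁ (back (suc k))) x
      descend zero = [ edge zero ]
      descend (suc k) = [ edge (suc k) ] ++⁺ descend k
      go : ∀ i j → i < j → proj₁ (back i) ≡ proj₁ (back j) → Walk⁺ E x x
      go zero (suc j) _ eq = subst (λ z → Walk⁺ E z x) (sym eq) (descend j)
      go (suc i) (suc j) (s≤s i<j) eq =
        go i j i<j (functional (edge i) (subst (λ z → T (E z (proj₁ (back j)))) (sym eq) (edge j)))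

  -- Merging and splitting components by exchanging the outgoing edges of two vertices.

  record Rewired (x y : Fin N) (E E′ : Graph {N}) : Set where
    field
      to   : ∀ {u w} → T (E u w) → T (E′ (transpose x y u) w)
      from : ∀ {u w} → T (E′ u w) → T (E (transpose x y u) w)

  Rewired-sym : ∀ {x y E E′} → Rewired x y E E′ → Rewired x y E′ E
  Rewired-sym r = record { to = Rewired.from r ; from = Rewired.to r }

  -- The exchange cuts the cycle open behind `x` and inserts it behind `y`, so exactly one component
  -- disappears.
  module Merge {E E′ : Graph {N}} {x y : Fin N} (rew : Rewired x y E E′)
               (cyc : Walk⁺ E x x) (x≁y : ¬ Conn E x y) where
    open Rewired rew

    edge-x : ∀ {w} → T (E x w) → T (E′ y w)
    edge-x {w} e = subst (λ u → T (E′ u w)) (transpose-left x y) (to e)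

    edge-y : ∀ {w} → T (E y w) → T (E′ x w)
    edge-y {w} e = subst (λ u → T (E′ u w)) (transpose-right x y) (to e)

    edge-other : ∀ {u w} → u ≢ x → u ≢ y → T (E u w) → T (E′ u w)
    edge-other {u} {w} u≢x u≢y e = subst (λ u → T (E′ u w)) (transpose-other u≢x u≢y) (to e)

    -- The edge leaving `x` now leaves `y`, and the rest of the cycle is unchanged: a return to `x`
    -- restarts the argument, and `y` is never met because of `x≁y`.
    y~walk : ∀ {z} → Walk⁺ E x z → Conn E′ y z
    y~walk [ e ] = fwd (edge-x e) ◅ ε
    y~walk (_▷_ {u} p e) with u ≟ x | u ≟ y
    ... | yes refl | _ = fwd (edge-x e) ◅ ε
    ... | no _ | yes refl = ⊥-elim (x≁y (Walk⁺⇒Conn p))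
    ... | no u≢x | no u≢y = y~walk p ◅◅ (fwd (edge-other u≢x u≢y e) ◅ ε)

    y~x : Conn E′ y x
    y~x = y~walk cyc

    Conn⇒Conn′ : ∀ {u v} → Conn E u v → Conn E′ u v
    Conn⇒Conn′ = EqC.fold (EqC.isEquivalence _) step
      where
      step : ∀ {u w} → T (E u w) → Conn E′ u w
      step {u} e with u ≟ x | u ≟ y
      ... | yes refl | _ = ~sym E′ y~x ◅◅ (fwd (edge-x e) ◅ ε)
      ... | no _ | yes refl = y~x ◅◅ (fwd (edge-y e) ◅ ε)
      ... | no u≢x | no u≢y = fwd (edge-other u≢x u≢y e) ◅ ε

    Touched : Fin N → Set
    Touched u = Conn E u x ⊎ Conn E u y

    touched-resp : ∀ {u v} → Conn E u v → Touched v → Touched u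
    touched-resp c (inj₁ t) = inj₁ (c ◅◅ t)
    touched-resp c (inj₂ t) = inj₂ (c ◅◅ t)

    -- The equivalence obtained from `Conn E` by gluing the classes of `x` and `y`. It contains
    -- every new edge, hence all of `Conn E′`.
    Merged : Fin N → Fin N → Set
    Merged u v = Conn E u v ⊎ (Touched u × Touched v)

    Conn′⇒Merged : ∀ {u v} → Conn E′ u v → Merged u v
    Conn′⇒Merged = EqC.fold
      (record { refl = inj₁ ε ; sym = msym ; trans = mtrans }) step
      where
      msym : ∀ {u v} → Merged u v → Merged v u
      msym (inj₁ c) = inj₁ (~sym E c)
      msym (inj₂ (s , t)) = inj₂ (t , s)
      mtrans : ∀ {u v w} → Merged u v → Merged v w → Merged u w
      mtrans (inj₁ c) (inj₁ c′) = inj₁ (c ◅◅ c′)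
      mtrans (inj₁ c) (inj₂ (s , t)) = inj₂ (touched-resp c s , t)
      mtrans (inj₂ (s , t)) (inj₁ c) = inj₂ (s , touched-resp (~sym E c) t)
      mtrans (inj₂ (s , _)) (inj₂ (_ , t)) = inj₂ (s , t)
      step : ∀ {u w} → T (E′ u w) → Merged u w
      step {u} {w} e with transpose-cases x y u
      ... | inj₁ (refl , eq) = inj₂ (inj₁ ε , inj₂ (bwd (subst (λ u → T (E u w)) eq (from e)) ◅ ε))
      ... | inj₂ (inj₁ (refl , eq)) = inj₂ (inj₂ ε , inj₁ (bwd (subst (λ u → T (E u w)) eq (from e)) ◅ ε))
      ... | inj₂ (inj₂ (_ , _ , eq)) = inj₁ (fwd (subst (λ u → T (E u w)) eq (from e)) ◅ ε)

    module _ (V : Subset N) (x∈ : T (lookup V x)) (y∈ : T (lookup V y)) where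

      -- `nothing` stands for the component of `x` in `E`. The other components of `E` correspond to
      -- those of `E′`, the component of `y` to the merged one.
      nothing∷reps : List (Maybe (Fin N))
      nothing∷reps = nothing ∷ map just (reps E′ V)

      length-nothing∷reps : length nothing∷reps ≡ suc (numComponents V E′)
      length-nothing∷reps = cong suc (List.length-map just (reps E′ V))

      just∈⁻ : ∀ {r} → just r ∈ nothing∷reps → T (isRep V E′ r)
      just∈⁻ (there p) with ∈-map⁻ just p
      ... | _ , r∈ , refl = ∈-filterFin⁻ r∈

      components-≤ : numComponents V E ≤ suc (numComponents V E′)
      components-≤ = subst (numComponents V E ≤_) length-nothing∷reps (numComponents-≤ E V R total inj)
        where
        R : Fin N → Maybe (Fin N) → Set
        R u nothing  = Conn E u x
        R u (just r) = ¬ Conn E u x × Conn E′ u r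
        total : ∀ u → T (lookup V u) → ∃ λ m → m ∈ nothing∷reps × R u m
        total u u∈ with Conn? E u x
        ... | yes c = nothing , here refl , c
        ... | no ¬c with rep-exists E′ V u u∈
        ...   | r , r-rep , u~r = just r , there (∈-map⁺ just (∈-filterFin⁺ r-rep)) , ¬c , u~r
        inj : ∀ {u u′ m} → R u m → R u′ m → Conn E u u′
        inj {m = nothing} c c′ = c ◅◅ ~sym E c′
        inj {m = just r} (¬c , c) (¬c′ , c′) with Conn′⇒Merged (c ◅◅ ~sym E′ c′)
        ... | inj₁ u~u′ = u~u′
        ... | inj₂ (inj₁ t , _) = ⊥-elim (¬c t)
        ... | inj₂ (_ , inj₁ t) = ⊥-elim (¬c′ t)
        ... | inj₂ (inj₂ t , inj₂ t′) = t ◅◅ ~sym E t′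

      components-≥ : suc (numComponents V E′) ≤ numComponents V E
      components-≥ = subst (_≤ numComponents V E) length-nothing∷reps
          (relation⇒length≤ R {ys = reps E V}
            (unique-∷ (λ p → nothing∉ (∈-map⁻ just p)) (Unique.map⁺ just-injective (filterFin-unique _)))
            total inj)
        where
        nothing∉ : ¬ (∃ λ r → r ∈ reps E′ V × nothing ≡ just r)
        nothing∉ (_ , _ , ())
        R : Maybe (Fin N) → Fin N → Set
        R nothing  r = Conn E r x
        R (just u) r = ¬ Conn E r x × Conn E′ r u
        total : ∀ {m} → m ∈ nothing∷reps → ∃ λ r → r ∈ reps E V × R m r
        total {nothing} _ with rep-exists E V x x∈
        ... | r , r-rep , c = r , ∈-filterFin⁺ r-rep , ~sym E c
        total {just u} m∈ with Conn? E u x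
        -- The representative of the merged component may come from the class of `x`, which already
        -- belongs to `nothing`; the class of `y` is used in its place.
        ... | yes u~x with rep-exists E V y y∈
        ...   | r , r-rep , c = r , ∈-filterFin⁺ r-rep , (λ r~x → x≁y (~sym E (c ◅◅ r~x)))
                , Conn⇒Conn′ (~sym E c) ◅◅ y~x ◅◅ Conn⇒Conn′ (~sym E u~x)
        total {just u} m∈ | no u≁x with rep-exists E V u (proj₁ (∧⁻ (just∈⁻ m∈)))
        ...   | r , r-rep , c = r , ∈-filterFin⁺ r-rep , (λ r~x → u≁x (c ◅◅ r~x)) , Conn⇒Conn′ (~sym E c)
        inj : ∀ {m m′ r} → m ∈ nothing∷reps → m′ ∈ nothing∷reps → R m r → R m′ r → m ≡ m′
        inj {nothing} {nothing} _ _ _ _ = refl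
        inj {nothing} {just _} _ _ c (¬c , _) = ⊥-elim (¬c c)
        inj {just _} {nothing} _ _ (¬c , _) c = ⊥-elim (¬c c)
        inj {just _} {just _} p p′ (_ , c) (_ , c′) =
          cong just (rep-unique E′ V (just∈⁻ p) (just∈⁻ p′) (~sym E′ c ◅◅ c′))

      merge : numComponents V E ≡ suc (numComponents V E′)
      merge = ℕ.≤-antisym components-≤ components-≥

  module _ {E E′ : Graph {N}} {b x : Fin N} (pinj′ : PartialInjection E′) (rew : Rewired x b E E′)
           (noIn : NoIn E b) (p : Walk⁺ E b x) (V : Subset N) (x∈ : T (lookup V x)) (b∈ : T (lookup V b)) where
    open Rewired rew

    -- The edge leaving `b` now leaves `x`, so a walk from `b` turns into a walk from `x` until it
    -- reaches `x`, where it closes up. It cannot return to `b`, which has no incoming edge.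
    split-cycle : ∀ {z} → Walk⁺ E b z → Walk⁺ E′ x x ⊎ Walk⁺ E′ x z
    split-cycle {z} [ e ] = inj₂ [ subst (λ u → T (E′ u z)) (transpose-right x b) (to e) ]
    split-cycle {z} (_▷_ {u} q e) with split-cycle q
    ... | inj₁ c = inj₁ c
    ... | inj₂ c with transpose-cases x b u
    ...   | inj₁ (refl , _) = inj₁ c
    ...   | inj₂ (inj₁ (refl , _)) = ⊥-elim (noIn (proj₂ (last-edge q)))
    ...   | inj₂ (inj₂ (_ , _ , eq)) = inj₂ (c ▷ subst (λ u → T (E′ u z)) eq (to e))

    -- The reverse exchange merges the cycle found by `split-cycle` with the component of `b`. The
    -- two are disjoint in `E′`: otherwise the cycle would contain an edge into `b`.
    split : numComponents V E′ ≡ suc (numComponents V E)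
    split = Merge.merge (Rewired-sym rew) cyc
        (λ c → noIn (from (proj₂ (last-edge (cycle-component pinj′ cyc c))))) V x∈ b∈
      where
      cyc : Walk⁺ E′ x x
      cyc with split-cycle p
      ... | inj₁ c = c
      ... | inj₂ c = c

  module _ (V : Subset N) {b b′ : Fin N} (b∈ : T (lookup V b)) (b′∈ : T (lookup V b′)) where

    -- No edge ends in `b` or `b′`, so exchanging their outgoing edges amounts to renaming the two
    -- vertices: the transposition is a graph isomorphism.
    relabel-≤ : ∀ {E E′} → Rewired b b′ E E′ → NoIn E b → NoIn E b′
      → numComponents V E′ ≤ numComponents V E
    relabel-≤ {E} {E′} rew noIn noIn′ = numComponents-≤ E′ V {ys = reps E V} (λ u r → Conn E (σ u) r) total inj
      where
      open Rewired rew
      σ : Fin N → Fin N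
      σ = transpose b b′
      total : ∀ u → T (lookup V u) → ∃ λ r → r ∈ reps E V × Conn E (σ u) r
      total u u∈ with rep-exists E V (σ u) (transpose-preserves (T ∘ lookup V) b∈ b′∈ u∈)
      ... | r , r-rep , c = r , ∈-filterFin⁺ r-rep , c
      edge : ∀ {u w} → T (E u w) → T (E′ (σ u) (σ w))
      edge {u} {w} e = subst (λ w → T (E′ (σ u) w))
        (sym (transpose-other (λ { refl → noIn e }) (λ { refl → noIn′ e }))) (to e)
      inj : ∀ {u u′ r} → Conn E (σ u) r → Conn E (σ u′) r → Conn E′ u u′
      inj c c′ = subst₂ (Conn E′) (transpose-involutive b b′ _) (transpose-involutive b b′ _)
        (EqC.gmap σ edge (c ◅◅ ~sym E c′))

    relabel : ∀ {E E′} → Rewired b b′ E E′ → NoIn E b → NoIn E b′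
      → numComponents V E′ ≡ numComponents V E
    relabel rew noIn noIn′ = ℕ.≤-antisym (relabel-≤ rew noIn noIn′)
      (relabel-≤ (Rewired-sym rew) (noIn ∘ Rewired.from rew) (noIn′ ∘ Rewired.from rew))

-- Iterates, periods and first visits.

least : {P : ℕ → Set} → Decidable P → ∀ n → P n → ∃ λ k → P k × (∀ {i} → i < k → ¬ P i)
least P? zero p = zero , p , λ ()
least P? (suc n) p with P? 0
... | yes p₀ = 0 , p₀ , λ ()
... | no ¬p₀ with least (P? ∘ suc) n p
...   | k , pk , min = suc k , pk , λ { {zero} _ → ¬p₀ ; {suc i} (s≤s i<k) → min i<k }

module _ {N : ℕ} where

  iter-+ : ∀ i j (h : Fin N → Fin N) x → iter (i + j) h x ≡ iter i h (iter j h x)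
  iter-+ zero    j h x = refl
  iter-+ (suc i) j h x = cong h (iter-+ i j h x)

  iter-shift : ∀ i (h : Fin N → Fin N) x → iter i h (h x) ≡ iter (suc i) h x
  iter-shift zero    h x = refl
  iter-shift (suc i) h x = cong h (iter-shift i h x)

  -- Two of the first `N + 1` iterates coincide, and the loop between them can be cut out. This
  -- meets the bound `upTo N` in `isCyclicOn`.
  iter-shorten : ∀ (h : Fin N → Fin N) i {x y} → iter i h x ≡ y → ∃ λ k → k < N × iter k h x ≡ y
  iter-shorten h i {x} {y} = go i (<-wellFounded i)
    where
    go : ∀ i → Acc _<_ i → iter i h x ≡ y → ∃ λ k → k < N × iter k h x ≡ y
    go i (acc rec) eq with i <? N
    ... | yes i<N = i , i<N , eq
    ... | no i≮N with Fin.pigeonhole (ℕ.n<1+n N) (λ m → iter (toℕ m) h x)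
    ...   | p , q , p<q , same = go (i ∸ toℕ q + toℕ p)
              (rec (subst (i ∸ toℕ q + toℕ p <_) i≡ (ℕ.+-monoʳ-< (i ∸ toℕ q) p<q)))
              (begin
                iter (i ∸ toℕ q + toℕ p) h x        ≡⟨ iter-+ (i ∸ toℕ q) (toℕ p) h x ⟩
                iter (i ∸ toℕ q) h (iter (toℕ p) h x) ≡⟨ cong (iter (i ∸ toℕ q) h) same ⟩
                iter (i ∸ toℕ q) h (iter (toℕ q) h x) ≡⟨ iter-+ (i ∸ toℕ q) (toℕ q) h x ⟨
                iter (i ∸ toℕ q + toℕ q) h x        ≡⟨ cong (λ m → iter m h x) i≡ ⟩
                iter i h x                          ≡⟨ eq ⟩
                y                                   ∎)
      where
      open ≡-Reasoning
      i≡ : i ∸ toℕ q + toℕ q ≡ i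
      i≡ = ℕ.m∸n+n≡m (ℕ.≤-trans (ℕ.≤-pred (Fin.toℕ<n q)) (ℕ.≮⇒≥ i≮N))

  Injective : (Fin N → Fin N) → Set
  Injective h = ∀ {x y} → h x ≡ h y → x ≡ y

  iter-periodic : ∀ {h} → Injective h → ∀ x → ∃ λ r → iter (suc r) h x ≡ x
  iter-periodic {h} inj x =
      let p , q , p<q , same = Fin.pigeonhole (ℕ.n<1+n N) (λ m → iter (toℕ m) h x)
      in go (toℕ p) (toℕ q) p<q same
    where
    go : ∀ p q → p < q → iter p h x ≡ iter q h x → ∃ λ r → iter (suc r) h x ≡ x
    go zero    (suc q) _         eq = q , sym eq
    go (suc p) (suc q) (s≤s p<q) eq = go p q p<q (inj eq)

  -- Going once around the period replaces each backward step by forward steps.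
  iter-back : ∀ {h} → Injective h → ∀ i {x y} → iter i h x ≡ y → ∃ λ k → iter k h y ≡ x
  iter-back inj zero eq = 0 , sym eq
  iter-back {h} inj (suc i) {x} refl
    with iter-back inj i {x} refl | iter-periodic inj (iter i h x)
  ... | k , back | r , per = k + r , trans (iter-+ k r h _)
          (trans (cong (iter k h) (trans (iter-shift r h _) per)) back)

  FirstHit : (Fin N → Fin N) → Fin N → Fin N → ℕ → Set
  FirstHit s b x j = iter j s b ≡ x × (∀ {i} → i < j → iter i s b ≢ x)

  firstHit : ∀ s b {x} i → iter i s b ≡ x → ∃ (FirstHit s b x)
  firstHit s b {x} i = least (λ i → iter i s b ≟ x) i

  -- After a repetition, the stretch from `k` to `j` could be run from position `i` already and
  -- would hit `x` too early.
  distinct : ∀ {s b x j} → FirstHit s b x j → ∀ {i k} → i < k → k ≤ j → iter i s b ≢ iter k s b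
  distinct {s} {b} {x} {j} (hit , first) {i} {k} i<k k≤j eq =
    first (subst (j ∸ k + i <_) j≡ (ℕ.+-monoʳ-< (j ∸ k) i<k))
      (begin
        iter (j ∸ k + i) s b        ≡⟨ iter-+ (j ∸ k) i s b ⟩
        iter (j ∸ k) s (iter i s b) ≡⟨ cong (iter (j ∸ k) s) eq ⟩
        iter (j ∸ k) s (iter k s b) ≡⟨ iter-+ (j ∸ k) k s b ⟨
        iter (j ∸ k + k) s b        ≡⟨ cong (λ m → iter m s b) j≡ ⟩
        iter j s b                  ≡⟨ hit ⟩
        x                           ∎)
    where
    open ≡-Reasoning
    j≡ : j ∸ k + k ≡ j
    j≡ = ℕ.m∸n+n≡m k≤j

  -- Cyclic permutations of a subset.

  record CyclicOn (A : Subset N) (s : Fin N → Fin N) : Set where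
    field
      closed     : ∀ {x} → T (lookup A x) → T (lookup A (s x))
      fixed      : ∀ {x} → ¬ T (lookup A x) → s x ≡ x
      injective  : Injective s
      transitive : ∀ {x y} → T (lookup A x) → T (lookup A y) → ∃ λ i → iter i s x ≡ y

  T-if⁻ : ∀ {c t e} → T (if c then t else e) → (T c → T t) × (¬ T c → T e)
  T-if⁻ {true}  h = (λ _ → h) , (λ ¬c → ⊥-elim (¬c _))
  T-if⁻ {false} h = (λ ()) , (λ _ → h)

  T-if⁺ : ∀ {c t e} → (T c → T t) → (¬ T c → T e) → T (if c then t else e)
  T-if⁺ {true}  p q = p _
  T-if⁺ {false} p q = q id

  implies⁻ : ∀ {c e} → T (not c ∨ e) → T c → T e
  implies⁻ {true} h _ = h

  implies⁺ : ∀ {c e} → (T c → T e) → T (not c ∨ e)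
  implies⁺ {true}  h = h _
  implies⁺ {false} h = _

  isCyclicOn⇒CyclicOn : ∀ {A s} → T (isCyclicOn A s) → CyclicOn A s
  isCyclicOn⇒CyclicOn {A} {s} h with ∧⁻ h
  ... | h₁ , h′ with ∧⁻ h′
  ...   | h₂ , h₃ = record { closed = closed ; fixed = fixed ; injective = inj ; transitive = trns }
    where
    closed : ∀ {x} → T (lookup A x) → T (lookup A (s x))
    closed {x} = proj₁ (T-if⁻ {lookup A x} (allFin⁻ _ h₁ x))
    fixed : ∀ {x} → ¬ T (lookup A x) → s x ≡ x
    fixed {x} x∉ = toWitness (proj₂ (T-if⁻ {lookup A x} (allFin⁻ _ h₁ x)) x∉)
    inj : Injective s
    inj {x} {y} eq with T? (lookup A x) | T? (lookup A y)
    ... | yes x∈ | yes y∈ = toWitness (implies⁻ (allFin⁻ _ (allFin⁻ _ h₂ x) y) (∧⁺ x∈ (∧⁺ y∈ (fromWitness eq))))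
    ... | yes x∈ | no y∉  = ⊥-elim (y∉ (subst (T ∘ lookup A) (trans eq (fixed y∉)) (closed x∈)))
    ... | no x∉  | yes y∈ = ⊥-elim (x∉ (subst (T ∘ lookup A) (trans (sym eq) (fixed x∉)) (closed y∈)))
    ... | no x∉  | no y∉  = trans (sym (fixed x∉)) (trans eq (fixed y∉))
    trns : ∀ {x y} → T (lookup A x) → T (lookup A y) → ∃ λ i → iter i s x ≡ y
    trns {x} {y} x∈ y∈ with find (Any.any⁻ (λ i → iter i s x == y) (upTo N)
                             (implies⁻ (allFin⁻ _ (allFin⁻ _ h₃ x) y) (∧⁺ x∈ y∈)))
    ... | i , _ , eq = i , toWitness eq

  CyclicOn⇒isCyclicOn : ∀ {A s} → CyclicOn A s → T (isCyclicOn A s)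
  CyclicOn⇒isCyclicOn {A} {s} cyc = ∧⁺
      (allFin⁺ _ λ x → T-if⁺ {lookup A x} closed (fromWitness ∘ fixed))
      (∧⁺ (allFin⁺ _ λ x → allFin⁺ _ λ y → implies⁺ λ h →
             fromWitness (injective (toWitness (proj₂ (∧⁻ {lookup A y} (proj₂ (∧⁻ {lookup A x} h)))))))
          (allFin⁺ _ λ x → allFin⁺ (λ y → not (lookup A x ∧ lookup A y) ∨ any (λ i → iter i s x == y) (upTo N))
                                   λ y → implies⁺ λ h → hit (∧⁻ h)))
    where
    open CyclicOn cyc
    hit : ∀ {x y} → T (lookup A x) × T (lookup A y) → T (any (λ i → iter i s x == y) (upTo N))
    hit {x} {y} (x∈ , y∈) =
      let i , eq = transitive x∈ y∈ ; k , k<N , eq′ = iter-shorten s i eq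
      in Any.any⁺ (λ i → iter i s x == y) (lose (∈-upTo⁺ k<N) (fromWitness eq′))

  iter-closed : ∀ {A s} → CyclicOn A s → ∀ i {x} → T (lookup A x) → T (lookup A (iter i s x))
  iter-closed cyc zero    x∈ = x∈
  iter-closed cyc (suc i) x∈ = CyclicOn.closed cyc (iter-closed cyc i x∈)

  -- The exchange of two blocks of a cyclic permutation.

  record Order (s : Fin N → Fin N) (b a b′ : Fin N) : Set where
    field
      k j  : ℕ
      0<k  : 0 < k
      k<j  : k < j
      a-at : iter k s b ≡ a
      b′-at : FirstHit s b b′ j

  -- If `s` runs through `b P a Q b′ R` with blocks `P`, `Q`, `R`, then `s′` runs through
  -- `b Q b′ P a R`. It is again a single cycle on `A`.
  module ThreeCycle {A : Subset N} {s s′ : Fin N → Fin N} {b a b′ : Fin N}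
      (cyc : CyclicOn A s) (b∈ : T (lookup A b)) (ord : Order s b a b′)
      (s′≗ : ∀ u → s′ u ≡ s (transpose a b′ (transpose b b′ u))) where
    open Order ord
    open CyclicOn cyc

    a∈ : T (lookup A a)
    a∈ = subst (T ∘ lookup A) a-at (iter-closed cyc k b∈)

    b′∈ : T (lookup A b′)
    b′∈ = subst (T ∘ lookup A) (proj₁ b′-at) (iter-closed cyc j b∈)

    b≢a : b ≢ a
    b≢a eq = distinct b′-at 0<k (ℕ.<⇒≤ k<j) (trans eq (sym a-at))

    b≢b′ : b ≢ b′
    b≢b′ = proj₂ b′-at (ℕ.<-trans 0<k k<j)

    a≢b′ : a ≢ b′
    a≢b′ eq = proj₂ b′-at k<j (trans a-at eq)

    s′-b : s′ b ≡ s a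
    s′-b = trans (s′≗ b) (cong s (trans (cong (transpose a b′) (transpose-left b b′)) (transpose-right a b′)))

    s′-b′ : s′ b′ ≡ s b
    s′-b′ = trans (s′≗ b′) (cong s (trans (cong (transpose a b′) (transpose-right b b′)) (transpose-other b≢a b≢b′)))

    s′-a : s′ a ≡ s b′
    s′-a = trans (s′≗ a) (cong s (trans (cong (transpose a b′) (transpose-other (b≢a ∘ sym) a≢b′)) (transpose-left a b′)))

    s′-other : ∀ {u} → u ≢ b → u ≢ a → u ≢ b′ → s′ u ≡ s u
    s′-other {u} u≢b u≢a u≢b′ = trans (s′≗ u)
      (cong s (trans (cong (transpose a b′) (transpose-other u≢b u≢b′)) (transpose-other u≢a u≢b′)))

    s′-injective : Injective s′
    s′-injective {x} {y} eq = transpose-injective b b′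
      (transpose-injective a b′ (injective (trans (sym (s′≗ x)) (trans eq (s′≗ y)))))

    -- The block between `b` and `a` keeps its order but is now entered from `b′`. The left side
    -- depends on `s′` and `b′` only, so two permutations with the same image `s′` can be compared
    -- along it.
    segment : ∀ m → suc m ≤ k → iter (suc m) s′ b′ ≡ iter (suc m) s b
    segment zero    _ = s′-b′
    segment (suc m) m<k = trans (cong s′ (segment m (ℕ.<⇒≤ m<k))) (s′-other
      (λ eq → distinct b′-at {0} z<s (ℕ.<⇒≤ (ℕ.<-trans m<k k<j)) (sym eq))
      (λ eq → distinct b′-at m<k (ℕ.<⇒≤ k<j) (trans eq (sym a-at)))
      (proj₂ b′-at (ℕ.<-trans m<k k<j)))

    Reach : Fin N → Set
    Reach y = ∃ λ i → iter i s′ b ≡ y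

    step : ∀ {u v} → Reach u → s′ u ≡ v → Reach v
    step (i , refl) eq = suc i , eq

    reach-middle : ∀ m → suc m + k ≤ j → Reach (iter (suc m + k) s b)
    reach-middle zero _ = 1 , trans s′-b (cong s (sym a-at))
    reach-middle (suc m) lt = step (reach-middle m (ℕ.<⇒≤ lt)) (s′-other
      (λ eq → distinct b′-at {0} z<s (ℕ.<⇒≤ lt) (sym eq))
      (λ eq → distinct b′-at (s≤s (ℕ.m≤n+m k m)) (ℕ.<⇒≤ lt) (trans a-at (sym eq)))
      (proj₂ b′-at lt))

    split-at : ∀ {p q} → p < q → ∃ λ m → suc m + p ≡ q
    split-at {p} {q} p<q = q ∸ suc p , trans (sym (ℕ.+-suc _ p)) (ℕ.m∸n+n≡m p<q)

    reach-b′ : Reach b′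
    reach-b′ with split-at k<j
    ... | m , eq = subst Reach (trans (cong (λ i → iter i s b) eq) (proj₁ b′-at)) (reach-middle m (ℕ.≤-reflexive eq))

    reach-first : ∀ m → suc m ≤ k → Reach (iter (suc m) s b)
    reach-first m lt = let i , eq = reach-b′ in suc m + i ,
      trans (iter-+ (suc m) i s′ b) (trans (cong (iter (suc m) s′) eq) (segment m lt))

    reach-upto : ∀ i → i ≤ k → Reach (iter i s b)
    reach-upto zero    _  = 0 , refl
    reach-upto (suc m) le = reach-first m le

    -- The block behind `b′` is now entered from `a`. Since `l` is the first visit to `y`, the
    -- positions before it are distinct, so `b`, `a` and `b′` do not recur inside the block.
    reach-last : ∀ {y l} → FirstHit s b y l → ∀ m → suc m + j ≤ l → Reach (iter (suc m + j) s b)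
    reach-last hit zero _ = step (subst Reach a-at (reach-upto k ℕ.≤-refl)) (trans s′-a (cong s (sym (proj₁ b′-at))))
    reach-last hit (suc m) lt = step (reach-last hit m (ℕ.<⇒≤ lt)) (s′-other
      (λ eq → distinct hit {0} z<s (ℕ.<⇒≤ lt) (sym eq))
      (λ eq → distinct hit (ℕ.<-trans k<j (s≤s (ℕ.m≤n+m j m))) (ℕ.<⇒≤ lt) (trans a-at (sym eq)))
      (λ eq → distinct hit (s≤s (ℕ.m≤n+m j m)) (ℕ.<⇒≤ lt) (trans (proj₁ b′-at) (sym eq))))

    reach-all : ∀ {y} → T (lookup A y) → Reach y
    reach-all {y} y∈ with transitive b∈ y∈
    ... | i , eq with firstHit s b i eq
    ... | l , hit@(refl , _) with ℕ.≤-<-connex l k | ℕ.≤-<-connex l j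
    ...   | inj₁ l≤k | _ = reach-upto l l≤k
    ...   | inj₂ k<l | inj₁ l≤j with split-at k<l
    ...     | m , refl = reach-middle m l≤j
    reach-all {y} y∈ | i , eq | l , hit@(refl , _) | inj₂ k<l | inj₂ j<l with split-at j<l
    ...     | m , refl = reach-last hit m ℕ.≤-refl

    cyclic : CyclicOn A s′
    cyclic = record { closed = cl ; fixed = fx ; injective = s′-injective ; transitive = tr }
      where
      cl : ∀ {x} → T (lookup A x) → T (lookup A (s′ x))
      cl {x} x∈ = subst (T ∘ lookup A) (sym (s′≗ x))
        (closed (transpose-preserves (T ∘ lookup A) a∈ b′∈ (transpose-preserves (T ∘ lookup A) b∈ b′∈ x∈)))
      fx : ∀ {x} → ¬ T (lookup A x) → s′ x ≡ x
      fx x∉ = trans (s′-other (λ { refl → x∉ b∈ }) (λ { refl → x∉ a∈ }) (λ { refl → x∉ b′∈ })) (fixed x∉)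
      tr : ∀ {x y} → T (lookup A x) → T (lookup A y) → ∃ λ i → iter i s′ x ≡ y
      -- From `x` the orbit is followed round to `b`, and from there to `y`.
      tr x∈ y∈ = let p , eq = reach-all x∈ ; q , eq′ = iter-back s′-injective p eq ; r , eq″ = reach-all y∈
        in r + q , trans (iter-+ r q s′ _) (trans (cong (iter r s′) eq′) eq″)

-- Subsets as lists of elements.

∈⁺ : ∀ {N} {S : Subset N} {x} → T (lookup S x) → x Subset.∈ S
∈⁺ {S = S} {x} h = Vec.lookup⇒[]= x S (Equivalence.to T-≡ h)

∈⁻ : ∀ {N} {S : Subset N} {x} → x Subset.∈ S → T (lookup S x)
∈⁻ h = Equivalence.from T-≡ (Vec.[]=⇒lookup h)

elements : ∀ {N} → Subset N → List (Fin N)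
elements []            = []
elements (inside  ∷ S) = zero ∷ map suc (elements S)
elements (outside ∷ S) = map suc (elements S)

length-elements : ∀ {N} (S : Subset N) → length (elements S) ≡ ∣ S ∣
length-elements []            = refl
length-elements (inside  ∷ S) = cong suc (trans (List.length-map suc (elements S)) (length-elements S))
length-elements (outside ∷ S) = trans (List.length-map suc (elements S)) (length-elements S)

∈-elements : ∀ {N} (S : Subset N) {x} → T (lookup S x) → x ∈ elements S
∈-elements (inside  ∷ S) {zero}  _ = here refl
∈-elements (inside  ∷ S) {suc x} h = there (∈-map⁺ suc (∈-elements S h))
∈-elements (outside ∷ S) {suc x} h = ∈-map⁺ suc (∈-elements S h)

first-edge : ∀ {N} {E : Graph {N}} {x z} → Walk⁺ E x z → ∃ λ w → T (E x w)
first-edge [ e ]   = _ , e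
first-edge (p ▷ _) = first-edge p

-- Paths and cycles of D and of f.

module Bijection {N : ℕ} {A B : Subset N} {d : Fin N → Fin N} (bij : IsBijection B A d) where

  InA InB InV : Fin N → Set
  InA x = T (lookup A x)
  InB x = T (lookup B x)
  InV x = T (lookup (A ∪ B) x)

  A⇒V : ∀ {x} → InA x → InV x
  A⇒V h = ∈⁻ (x∈p∪q⁺ {p = A} {q = B} (inj₁ (∈⁺ h)))

  B⇒V : ∀ {x} → InB x → InV x
  B⇒V h = ∈⁻ (x∈p∪q⁺ {p = A} {q = B} (inj₂ (∈⁺ h)))

  V⇒A⊎B : ∀ {x} → InV x → InA x ⊎ InB x
  V⇒A⊎B h with x∈p∪q⁻ A B (∈⁺ h)
  ... | inj₁ p = inj₁ (∈⁻ p)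
  ... | inj₂ p = inj₂ (∈⁻ p)

  d-closed : ∀ {x} → InB x → InA (d x)
  d-closed h = ∈⁻ (proj₁ bij _ (∈⁺ h))

  d-injective : ∀ {x y} → InB x → InB y → d x ≡ d y → x ≡ y
  d-injective p q = proj₁ (proj₂ bij) _ _ (∈⁺ p) (∈⁺ q)

  d-surjective : ∀ {y} → InA y → ∃ λ x → InB x × d x ≡ y
  d-surjective h = let x , p , eq = proj₂ (proj₂ bij) _ (∈⁺ h) in x , ∈⁻ p , eq

  D : Graph {N}
  D = graphD B d

  F : (Fin N → Fin N) → Graph {N}
  F = graphF A B d

  F-edge⁺ : ∀ s {u w} → InA u → InB w → d w ≡ s u → T (F s u w)
  F-edge⁺ s p q eq = ∧⁺ p (∧⁺ q (fromWitness eq))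

  F-edge⁻ : ∀ s {u w} → T (F s u w) → InA u × InB w × d w ≡ s u
  F-edge⁻ s {u} {w} e =
    let p , e′ = ∧⁻ {lookup A u} e ; q , eq = ∧⁻ {lookup B w} e′ in p , q , toWitness eq

  D-edge⁺ : ∀ {x} → InB x → T (D x (d x))
  D-edge⁺ p = ∧⁺ p (fromWitness refl)

  D-edge⁻ : ∀ {x y} → T (D x y) → InB x × d x ≡ y
  D-edge⁻ {x} e = let p , eq = ∧⁻ {lookup B x} e in p , toWitness eq

  F-partialInjection : ∀ {s} → Injective s → PartialInjection (F s)
  F-partialInjection {s} s-inj = record
    { functional = λ e e′ → let _ , q , eq = F-edge⁻ s e ; _ , q′ , eq′ = F-edge⁻ s e′
                            in d-injective q q′ (trans eq (sym eq′))
    ; injective  = λ e e′ → let _ , _ , eq = F-edge⁻ s e ; _ , _ , eq′ = F-edge⁻ s e′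
                            in s-inj (trans (sym eq) eq′) }

  Start : Fin N → Set
  Start b = InA b × ¬ InB b

  Start? : ∀ b → Dec (Start b)
  Start? b = T? (lookup A b) ×-dec ¬? (T? (lookup B b))

  start-noIn : ∀ s {b} → Start b → NoIn (F s) b
  start-noIn s (_ , b∉) e = b∉ (proj₁ (proj₂ (F-edge⁻ s e)))

  Surjective : (Fin N → Fin N) → Set
  Surjective s = ∀ {y} → InA y → ∃ λ u → InA u × s u ≡ y

  F-pred : ∀ {s} → Surjective s → ∀ {w} → InB w → ∃ λ u → T (F s u w)
  F-pred {s} surj w∈ = let u , u∈ , eq = surj (d-closed w∈) in u , F-edge⁺ s u∈ w∈ (sym eq)

  F-Conn-V : ∀ s {x z} → InV x → Conn (F s) x z → InV z
  F-Conn-V s x∈ ε = x∈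
  F-Conn-V s x∈ (fwd e ◅ es) = F-Conn-V s (B⇒V (proj₁ (proj₂ (F-edge⁻ s e)))) es
  F-Conn-V s x∈ (bwd e ◅ es) = F-Conn-V s (A⇒V (proj₁ (F-edge⁻ s e))) es

  -- Being on a cycle is expressed by the absence of a start in the component. This form is
  -- decidable and visibly invariant under connectivity; `cycle-walk` recovers the cycle.
  OnCycle : (Fin N → Fin N) → Fin N → Set
  OnCycle s x = InV x × (∀ b → Start b → ¬ Conn (F s) x b)

  OnCycle? : ∀ s x → Dec (OnCycle s x)
  OnCycle? s x = T? (lookup (A ∪ B) x) ×-dec Fin.all? (λ b → Start? b →-dec ¬? (Conn? (F s) x b))

  -- A component without a start lies in `B`, and by surjectivity of `s` on `A` every vertex of `B`
  -- has a predecessor.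
  cycle-walk : ∀ {s x} → Injective s → Surjective s → OnCycle s x → Walk⁺ (F s) x x
  cycle-walk {s} s-inj surj (x∈ , noStart) = no-start⇒cycle (F-partialInjection s-inj) hasPred
    where
    hasPred : ∀ z → Conn (F s) _ z → ∃ λ u → T (F s u z)
    hasPred z c with T? (lookup B z) | V⇒A⊎B (F-Conn-V s x∈ c)
    ... | yes z∈B | _ = F-pred surj z∈B
    ... | no z∉B | inj₁ z∈A = ⊥-elim (noStart z (z∈A , z∉B) c)
    ... | no z∉B | inj₂ z∈B = ⊥-elim (z∉B z∈B)

  -- G_D with its edges reversed is F id.
  D⇒F : ∀ {x y} → Conn D x y → Conn (F id) x y
  D⇒F = EqC.fold (EqC.isEquivalence _) λ e → case (D-edge⁻ e)
    where
    case : ∀ {x y} → InB x × d x ≡ y → Conn (F id) x y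
    case (p , refl) = bwd (F-edge⁺ id (d-closed p) p refl) ◅ ε

  F⇒D : ∀ {x y} → Conn (F id) x y → Conn D x y
  F⇒D = EqC.fold (EqC.isEquivalence _) λ e → case (F-edge⁻ id e)
    where
    case : ∀ {x y} → InA x × InB y × d y ≡ x → Conn D x y
    case (_ , q , refl) = bwd (D-edge⁺ q) ◅ ε

  id-surjective : Surjective id
  id-surjective p = _ , p , refl

  -- The first two are the lists over which `cycleSizes` and `pathSizes` are formed, so their
  -- lengths are ℓ(μ) and ℓ(λ).
  cycleReps pathReps starts : List (Fin N)
  cycleReps = filterᵇ (λ x → isRep (A ∪ B) D x ∧ isCycleComp (A ∪ B) D x) (allFin N)
  pathReps  = filterᵇ (λ x → isRep (A ∪ B) D x ∧ not (isCycleComp (A ∪ B) D x)) (allFin N)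
  starts    = filterᵇ (λ x → lookup A x ∧ not (lookup B x)) (allFin N)

  cycleComp⁻ : ∀ {r y} → T (isCycleComp (A ∪ B) D r) → InV y → Conn D r y → InB y × InA y
  cycleComp⁻ {r} {y} h y∈ c
    with ∧⁻ (All.lookup (All.all⁺ (λ y → hasOut D y ∧ hasIn D y) (componentOf (A ∪ B) D r) h)
                        (∈-filterFin⁺ (∧⁺ y∈ (Conn⇒connected D c))))
  ... | out , in′ with anyFin⁻ (D y) out | anyFin⁻ (λ z → D z y) in′
  ...   | _ , e | z , e′ with D-edge⁻ {x = z} e′
  ...     | z∈ , refl = proj₁ (D-edge⁻ e) , d-closed z∈

  cycleComp⁺ : ∀ {r} → (∀ {y} → InV y → Conn D r y → InB y × InA y) → T (isCycleComp (A ∪ B) D r)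
  cycleComp⁺ {r} h = All.all⁻ _ {xs = componentOf (A ∪ B) D r} (All.tabulate λ y∈ → go (∧⁻ (∈-filterFin⁻ y∈)))
    where
    go : ∀ {y} → InV y × T (connected D r y) → T (hasOut D y ∧ hasIn D y)
    go {y} (y∈ , c) with h y∈ (connected⇒Conn D c)
    ... | y∈B , y∈A with d-surjective y∈A
    ...   | z , z∈ , refl = ∧⁺ (anyFin⁺ (D y) (d y) (D-edge⁺ y∈B)) (anyFin⁺ (λ u → D u y) z (D-edge⁺ z∈))

  -- A start has no outgoing edge in `D`, so its component is a path. In the reversed graph `F id`
  -- it has no incoming edge, so it is the only start of that path.
  starts≤paths : length starts ≤ length pathReps
  starts≤paths = relation⇒length≤ (λ b r → Conn D b r) (filterFin-unique _) total inj
    where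
    start⁻ : ∀ {b} → b ∈ starts → Start b
    start⁻ {b} b∈ = let p , q = ∧⁻ {lookup A b} (∈-filterFin⁻ b∈) in p , not⁻ q
    total : ∀ {b} → b ∈ starts → ∃ λ r → r ∈ pathReps × Conn D b r
    total {b} b∈ with start⁻ b∈
    ... | b∈A , b∉B with rep-exists D (A ∪ B) b (A⇒V b∈A)
    ...   | r , r-rep , c = r , ∈-filterFin⁺ (∧⁺ r-rep
              (not⁺ λ h → b∉B (proj₁ (cycleComp⁻ h (A⇒V b∈A) (~sym D c))))) , c
    inj : ∀ {b b′ r} → b ∈ starts → b′ ∈ starts → Conn D b r → Conn D b′ r → b ≡ b′
    inj p q c c′ = start-unique (F-partialInjection {id} id)
      (start-noIn id (start⁻ p)) (start-noIn id (start⁻ q)) (D⇒F (c ◅◅ ~sym D c′))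

  -- Without a start, every vertex of the component would lie on a cycle of `F id`, hence in both
  -- `A` and `B`, and `D` would have a cycle there.
  path-start : ∀ {r} → r ∈ pathReps → ∃ λ b → Start b × Conn D r b
  path-start {r} r∈ with Fin.any? (λ b → Start? b ×-dec Conn? D r b)
  ... | yes found = found
  ... | no none = ⊥-elim (not⁻ (proj₂ (∧⁻ {isRep (A ∪ B) D r} (∈-filterFin⁻ r∈))) (cycleComp⁺ both))
    where
    both : ∀ {y} → InV y → Conn D r y → InB y × InA y
    both {y} y∈ c with cycle-walk {id} id id-surjective (y∈ , λ b st c′ → none (b , st , c ◅◅ F⇒D c′))
    ... | w = proj₁ (proj₂ (F-edge⁻ id (proj₂ (last-edge w)))) , proj₁ (F-edge⁻ id (proj₂ (first-edge w)))

  two-starts : 2 ≤ length pathReps → ∃ λ b → ∃ λ b′ → Start b × Start b′ × b ≢ b′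
  two-starts = go pathReps (filterFin-unique _) id
    where
    go : ∀ rs → Unique rs → (∀ {r} → r ∈ rs → r ∈ pathReps) → 2 ≤ length rs
      → ∃ λ b → ∃ λ b′ → Start b × Start b′ × b ≢ b′
    go (r ∷ r′ ∷ _) ((r≢r′ ∷ _) ∷ _) sub (s≤s (s≤s _))
      with path-start (sub (here refl)) | path-start (sub (there (here refl)))
    ... | b , st , c | b′ , st′ , c′ = b , b′ , st , st′ ,
          λ { refl → r≢r′ (rep-unique D (A ∪ B) (isrep (here refl)) (isrep (there (here refl))) (c ◅◅ ~sym D c′)) }
      where
      isrep : ∀ {q} → q ∈ r ∷ r′ ∷ _ → T (isRep (A ∪ B) D q)
      isrep q∈ = proj₁ (∧⁻ (∈-filterFin⁻ (sub q∈)))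

  components : (Fin N → Fin N) → ℕ
  components s = numComponents (A ∪ B) (F s)

  -- If there were no cycle, each component would contain a start, and there would be at most as
  -- many components as starts.
  cycle-exists : ∀ s → length starts < components s → ∃ (OnCycle s)
  cycle-exists s lt with Fin.any? (OnCycle? s)
  ... | yes found = found
  ... | no none = ⊥-elim (ℕ.<⇒≱ lt (numComponents-≤ (F s) (A ∪ B) {ys = starts} (Conn (F s)) total
                    (λ c c′ → c ◅◅ ~sym (F s) c′)))
    where
    total : ∀ x → InV x → ∃ λ b → b ∈ starts × Conn (F s) x b
    total x x∈ with Fin.any? (λ b → Start? b ×-dec Conn? (F s) x b)
    ... | yes (b , (b∈ , b∉) , c) = b , ∈-filterFin⁺ (∧⁺ b∈ (not⁺ b∉)) , c
    ... | no ¬c = ⊥-elim (none (x , x∈ , λ b st c → ¬c (b , st , c)))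

  cyclic-surjective : ∀ {s} → CyclicOn A s → Surjective s
  cyclic-surjective {s} cyc {y} y∈ =
    let i , eq = CyclicOn.transitive cyc (CyclicOn.closed cyc y∈) y∈
    in iter i s y , iter-closed cyc i y∈ , trans (sym (iter-shift i s y)) eq

  -- Walk along s from b.  A component of F s is charged to its first visited element x; a cycle of D
  -- to the element x ∈ A whose image d x is its first visited element.  If both charge the same x, then
  -- x cannot be visited before d x, as it lies on the same cycle of D, but the step of s just
  -- before d x is already in the component of x.
  components-bound : ∀ {s b} → CyclicOn A s → Start b → components s + length cycleReps ≤ ∣ A ∣
  components-bound {s} {b} cyc (b∈A , b∉B) =
      subst₂ _≤_ len (length-elements A) (relation⇒length≤ R {ys = elements A} uniq total inj)
    where
    E : Graph {N}
    E = F s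
    both : List (Fin N ⊎ Fin N)
    both = map inj₁ (reps E (A ∪ B)) ++ map inj₂ cycleReps
    len : length both ≡ components s + length cycleReps
    len = trans (List.length-++ (map inj₁ (reps E (A ∪ B))))
      (cong₂ _+_ (List.length-map inj₁ (reps E (A ∪ B))) (List.length-map inj₂ cycleReps))
    inj₁∈⁻ : ∀ {r} → inj₁ r ∈ both → T (isRep (A ∪ B) E r)
    inj₁∈⁻ h with ∈-++⁻ (map inj₁ (reps E (A ∪ B))) h
    ... | inj₁ p with ∈-map⁻ inj₁ p
    ...   | _ , r∈ , refl = ∈-filterFin⁻ r∈
    inj₁∈⁻ h | inj₂ p with ∈-map⁻ inj₂ p
    ...   | _ , _ , ()
    inj₂∈⁻ : ∀ {r} → inj₂ r ∈ both → T (isRep (A ∪ B) D r) × T (isCycleComp (A ∪ B) D r)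
    inj₂∈⁻ h with ∈-++⁻ (map inj₁ (reps E (A ∪ B))) h
    ... | inj₂ p with ∈-map⁻ inj₂ p
    ...   | _ , r∈ , refl = ∧⁻ (∈-filterFin⁻ r∈)
    inj₂∈⁻ h | inj₁ p with ∈-map⁻ inj₁ p
    ...   | _ , _ , ()
    uniq : Unique both
    uniq = Unique.++⁺ (Unique.map⁺ inj₁-injective (filterFin-unique _)) (Unique.map⁺ inj₂-injective (filterFin-unique _))
      λ { (p , q) → apart (∈-map⁻ inj₁ p) (∈-map⁻ inj₂ q) }
      where
      apart : ∀ {z} {rs rs′ : List (Fin N)} → (∃ λ r → r ∈ rs × z ≡ inj₁ r) → (∃ λ r → r ∈ rs′ × z ≡ inj₂ r) → ⊥
      apart (_ , _ , refl) (_ , _ , ())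
    R : Fin N ⊎ Fin N → Fin N → Set
    R (inj₁ r) x = ∃ λ i → iter i s b ≡ x × Conn E x r × (∀ {j} → j < i → ¬ Conn E (iter j s b) r)
    R (inj₂ r) x = InB x × ∃ λ i → iter i s b ≡ d x × Conn D (d x) r × (∀ {j} → j < i → ¬ Conn D (iter j s b) r)
    visited : ∀ {r} → InV r → ∃ λ i → Conn E (iter i s b) r
    visited {r} r∈ with V⇒A⊎B r∈
    ... | inj₁ r∈A = let i , eq = CyclicOn.transitive cyc b∈A r∈A in i , subst (λ z → Conn E z r) (sym eq) ε
    -- The walk along `s` stays in `A`; a vertex of `B` is met through its predecessor in `F s`.
    ... | inj₂ r∈B with F-pred (cyclic-surjective cyc) r∈B
    ...   | u , e = let i , eq = CyclicOn.transitive cyc b∈A (proj₁ (F-edge⁻ s e))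
                    in i , subst (λ z → Conn E z r) (sym eq) (fwd e ◅ ε)
    total : ∀ {z} → z ∈ both → ∃ λ x → x ∈ elements A × R z x
    total {inj₁ r} z∈ with visited (proj₁ (∧⁻ (inj₁∈⁻ z∈)))
    ... | n , c with least (λ i → Conn? E (iter i s b) r) n c
    ...   | i , c′ , min = iter i s b , ∈-elements A (iter-closed cyc i b∈A) , i , refl , c′ , min
    total {inj₂ r} z∈ with inj₂∈⁻ z∈
    ... | r-rep , r-cyc with proj₁ (∧⁻ r-rep)
    ...   | r∈ with CyclicOn.transitive cyc b∈A (proj₂ (cycleComp⁻ r-cyc r∈ ε))
    ...     | n , eq with least (λ i → Conn? D (iter i s b) r) n (subst (λ z → Conn D z r) (sym eq) ε)
    ...       | i , c , min with d-surjective (iter-closed cyc i b∈A)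
    ...         | x , x∈B , dx≡ = x , ∈-elements A (proj₂ (cycleComp⁻ r-cyc (B⇒V x∈B) (~sym D c′ ◅◅ (bwd (D-edge⁺ x∈B) ◅ ε)))) ,
                    x∈B , i , sym dx≡ , c′ , min
      where
      c′ : Conn D (d x) r
      c′ = subst (λ z → Conn D z r) (sym dx≡) c
    clash : ∀ {r r′ x} → T (isCycleComp (A ∪ B) D r′) → R (inj₁ r) x → R (inj₂ r′) x → ⊥
    -- The first visited element of a cycle of `D` is not `b`, which lies outside `B`; so there is a
    -- step of `s` just before it.
    clash r′-cyc _ (_ , zero , refl , c , _) = b∉B (proj₁ (cycleComp⁻ r′-cyc (A⇒V b∈A) (~sym D c)))
    clash {r} {r′} r′-cyc (i , refl , cE , minE) (x∈B , suc j , dx≡ , cD , minD) with ℕ.≤-<-connex i j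
    ... | inj₁ i≤j = minD (s≤s i≤j) (fwd (D-edge⁺ x∈B) ◅ cD)
    ... | inj₂ j<i = minE j<i (fwd (F-edge⁺ s (iter-closed cyc j b∈A) x∈B (sym dx≡)) ◅ cE)
    inj : ∀ {z z′ x} → z ∈ both → z′ ∈ both → R z x → R z′ x → z ≡ z′
    inj {inj₁ r} {inj₁ r′} p p′ (_ , _ , c , _) (_ , _ , c′ , _) =
      cong inj₁ (rep-unique E (A ∪ B) (inj₁∈⁻ p) (inj₁∈⁻ p′) (~sym E c ◅◅ c′))
    inj {inj₂ r} {inj₂ r′} p p′ (_ , _ , _ , c , _) (_ , _ , _ , c′ , _) =
      cong inj₂ (rep-unique D (A ∪ B) (proj₁ (inj₂∈⁻ p)) (proj₁ (inj₂∈⁻ p′)) (~sym D c ◅◅ c′))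
    inj {inj₁ r} {inj₂ r′} p p′ h h′ = ⊥-elim (clash (proj₂ (inj₂∈⁻ p′)) h h′)
    inj {inj₂ r} {inj₁ r′} p p′ h h′ = ⊥-elim (clash (proj₂ (inj₂∈⁻ p)) h′ h)

  -- The exchange of cyclic permutations and its injectivity.

  rewired : ∀ {s s′ x y} → InA x → InA y → (∀ u → s′ u ≡ s (transpose x y u)) → Rewired x y (F s) (F s′)
  rewired {s} {s′} {x} {y} x∈ y∈ s′≗ = record
    { to   = λ {u} e → let p , q , eq = F-edge⁻ s e in
        F-edge⁺ s′ (transpose-preserves InA x∈ y∈ p) q
          (trans eq (sym (trans (s′≗ _) (cong s (transpose-involutive x y u)))))
    ; from = λ {u} e → let p , q , eq = F-edge⁻ s′ e in
        F-edge⁺ s (transpose-preserves InA x∈ y∈ p) q (trans eq (s′≗ u)) }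

  Maximal : (Fin N → Fin N) → Set
  Maximal s = ∀ {s′} → CyclicOn A s′ → components s′ ≤ components s

  Exchange : Fin N → Fin N → Fin N → (s s′ : Fin N → Fin N) → Set
  Exchange b a b′ s s′ = ∀ u → s′ u ≡ s (transpose a b′ (transpose b b′ u))

  module _ {b b′ : Fin N} (b-start : Start b) (b′-start : Start b′) where

    relabelled : ∀ {s s′} → (∀ u → s′ u ≡ s (transpose b b′ u)) → components s′ ≡ components s
    relabelled {s} {s′} s′≗ = relabel (A ∪ B) (A⇒V (proj₁ b-start)) (A⇒V (proj₁ b′-start))
      (rewired (proj₁ b-start) (proj₁ b′-start) s′≗) (start-noIn s b-start) (start-noIn s b′-start)

    -- Otherwise s could be rewired so as to split off a cycle from the path of b′.
    no-early-visit : ∀ {s x} → CyclicOn A s → Maximal s → Order s b x b′ → ¬ Conn (F s) b′ x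
    no-early-visit {s} {x} cyc maximal ord c = contra
        (start-component (F-partialInjection (CyclicOn.injective cyc)) (start-noIn s b′-start) c)
      where
      open ThreeCycle {s′ = λ u → s (transpose x b′ (transpose b b′ u))} cyc (proj₁ b-start) ord (λ _ → refl)
      -- Half of the exchange. It is not cyclic itself, but `relabelled` carries its component count
      -- over to the full exchange, which is.
      g : Fin N → Fin N
      g u = s (transpose x b′ u)
      g-pinj : PartialInjection (F g)
      g-pinj = F-partialInjection (transpose-injective x b′ ∘ CyclicOn.injective cyc)
      more : Walk⁺ (F s) b′ x → components g ≡ suc (components s)
      more w = split g-pinj (rewired a∈ (proj₁ b′-start) λ _ → refl) (start-noIn s b′-start) w
        (A ∪ B) (A⇒V a∈) (A⇒V (proj₁ b′-start))
      contra : b′ ≡ x ⊎ Walk⁺ (F s) b′ x → ⊥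
      contra (inj₁ b′≡x) = a≢b′ (sym b′≡x)
      contra (inj₂ w) = ℕ.1+n≰n (subst (_≤ components s) (trans (relabelled {g} λ _ → refl) (more w)) (maximal cyclic))

    -- The field `first` makes the choice of `a` canonical; injectivity of the exchange rests on it.
    record CycleBefore (s : Fin N → Fin N) : Set where
      field
        a       : Fin N
        ord     : Order s b a b′
        onCycle : OnCycle s a
        first   : ∀ {i} → i < Order.k ord → ¬ OnCycle s (iter i s b)
      open Order ord public

    module Exchanged {s s′} (cyc : CyclicOn A s) (cb : CycleBefore s)
                     (s′≗ : Exchange b (CycleBefore.a cb) b′ s s′) where
      open CycleBefore cb public
      open ThreeCycle {s′ = s′} cyc (proj₁ b-start) ord s′≗ public

      -- The stage with only the merge performed. Written through `s′`, it is literally the same map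
      -- for any two permutations with image `s′`.
      g : Fin N → Fin N
      g u = s′ (transpose b b′ u)

      g≗ : ∀ u → g u ≡ s (transpose a b′ u)
      g≗ u = trans (s′≗ (transpose b b′ u)) (cong (s ∘ transpose a b′) (transpose-involutive b b′ u))

      module M = Merge {E = F s} {E′ = F g} (rewired a∈ (proj₁ b′-start) g≗)
        (cycle-walk (CyclicOn.injective cyc) (cyclic-surjective cyc) onCycle)
        (proj₂ onCycle b′ b′-start)

      components-drop : components s ≡ suc (components s′)
      components-drop = trans (M.merge (A ∪ B) (A⇒V a∈) (A⇒V (proj₁ b′-start)))
        (cong suc (relabelled λ u → refl))

    module _ {s₁ s₂ s′} (cyc₁ : CyclicOn A s₁) (cyc₂ : CyclicOn A s₂)
             (cb₁ : CycleBefore s₁) (cb₂ : CycleBefore s₂)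
             (s′≗₁ : Exchange b (CycleBefore.a cb₁) b′ s₁ s′) (s′≗₂ : Exchange b (CycleBefore.a cb₂) b′ s₂ s′) where
      private
        module X₁ = Exchanged cyc₁ cb₁ s′≗₁
        module X₂ = Exchanged cyc₂ cb₂ s′≗₂

      -- Up to the earlier of the two positions, `s₁` and `s₂` from `b` both agree with `s′` from
      -- `b′`.
      a₂-in-s₁ : X₂.k ≤ X₁.k → iter X₂.k s₁ b ≡ X₂.a
      a₂-in-s₁ le = go X₂.k X₂.0<k le ℕ.≤-refl X₂.a-at
        where
        go : ∀ k → 0 < k → k ≤ X₁.k → k ≤ X₂.k → iter k s₂ b ≡ X₂.a → iter k s₁ b ≡ X₂.a
        go (suc m) _ le₁ le₂ eq = trans (sym (X₁.segment m le₁)) (trans (X₂.segment m le₂) eq)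

      -- In the common graph of `g`, `b′` is connected to `a₂`. That graph arises from `F s₁` by
      -- gluing the components of `a₁` and `b′`, so `a₂` belongs to one of them: `b′` contradicts
      -- maximality, `a₁` contradicts the choice of `a₁` as the first cycle element.
      not-earlier : Maximal s₁ → ¬ (X₂.k < X₁.k)
      not-earlier maximal lt = contra (X₁.M.Conn′⇒Merged X₂.M.y~x)
        where
        ord : Order s₁ b X₂.a b′
        ord = record { k = X₂.k ; j = X₁.j ; 0<k = X₂.0<k ; k<j = ℕ.<-trans lt X₁.k<j
                     ; a-at = a₂-in-s₁ (ℕ.<⇒≤ lt) ; b′-at = X₁.b′-at }
        contra : ¬ X₁.M.Merged b′ X₂.a
        contra (inj₁ c)            = no-early-visit cyc₁ maximal ord c
        contra (inj₂ (_ , inj₂ c)) = no-early-visit cyc₁ maximal ord (~sym (F s₁) c)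
        contra (inj₂ (_ , inj₁ c)) = X₁.first lt (subst (OnCycle s₁) (sym (a₂-in-s₁ (ℕ.<⇒≤ lt)))
          (A⇒V X₂.a∈ , λ b″ st c′ → proj₂ X₁.onCycle b″ st (~sym (F s₁) c ◅◅ c′)))

    exchange-injective : ∀ {s₁ s₂ s′} (cyc₁ : CyclicOn A s₁) (cyc₂ : CyclicOn A s₂) → Maximal s₁ → Maximal s₂
      → (cb₁ : CycleBefore s₁) (cb₂ : CycleBefore s₂)
      → Exchange b (CycleBefore.a cb₁) b′ s₁ s′ → Exchange b (CycleBefore.a cb₂) b′ s₂ s′
      → ∀ u → s₁ u ≡ s₂ u
    exchange-injective {s₁} {s₂} cyc₁ cyc₂ max₁ max₂ cb₁ cb₂ e₁ e₂ u
      with ℕ.<-cmp (CycleBefore.k cb₁) (CycleBefore.k cb₂)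
    ... | tri< lt _ _ = ⊥-elim (not-earlier cyc₂ cyc₁ cb₂ cb₁ e₂ e₁ max₂ lt)
    ... | tri> _ _ gt = ⊥-elim (not-earlier cyc₁ cyc₂ cb₁ cb₂ e₁ e₂ max₁ gt)
    -- Equal positions give the same `a`, and then both permutations are recovered from `g` by the
    -- same transposition.
    ... | tri≈ _ eq _ = begin
        s₁ u                                      ≡⟨ cong s₁ (transpose-involutive X₁.a b′ u) ⟨
        s₁ (transpose X₁.a b′ (transpose X₁.a b′ u)) ≡⟨ X₁.g≗ (transpose X₁.a b′ u) ⟨
        X₁.g (transpose X₁.a b′ u)                ≡⟨ cong (λ a → X₁.g (transpose a b′ u)) a₁≡a₂ ⟩
        X₂.g (transpose X₂.a b′ u)                ≡⟨ X₂.g≗ (transpose X₂.a b′ u) ⟩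
        s₂ (transpose X₂.a b′ (transpose X₂.a b′ u)) ≡⟨ cong s₂ (transpose-involutive X₂.a b′ u) ⟩
        s₂ u                                      ∎
      where
      open ≡-Reasoning
      module X₁ = Exchanged cyc₁ cb₁ e₁
      module X₂ = Exchanged cyc₂ cb₂ e₂
      a₁≡a₂ : X₁.a ≡ X₂.a
      a₁≡a₂ = trans (sym X₁.a-at) (trans (cong (λ k → iter k s₁ b) eq)
        (a₂-in-s₁ cyc₁ cyc₂ cb₁ cb₂ e₁ e₂ (ℕ.≤-reflexive (sym eq))))

  -- Let `k` be the position of the first cycle element after `b`, and `j` that of `b′`. They differ
  -- because a start is never on a cycle. If `j < k`, the same element is at position `k ∸ j` after
  -- `b′` and precedes the return to `b`.
  cycle-before : ∀ {s b b′} → CyclicOn A s → ∃ (OnCycle s) → (st : Start b) (st′ : Start b′) → b ≢ b′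
    → CycleBefore st st′ s ⊎ CycleBefore st′ st s
  cycle-before {s} {b} {b′} cyc (x , x-cyc) st st′ b≢b′
    -- A vertex on a cycle has an outgoing edge, hence lies in `A` and is visited by `s`.
    with CyclicOn.transitive cyc (proj₁ st)
           (proj₁ (F-edge⁻ s (proj₂ (first-edge (cycle-walk (CyclicOn.injective cyc) (cyclic-surjective cyc) x-cyc)))))
       | CyclicOn.transitive cyc (proj₁ st) (proj₁ st′)
       | CyclicOn.transitive cyc (proj₁ st′) (proj₁ st)
  ... | p , refl | q , eq | q′ , eq′
    with least (λ i → OnCycle? s (iter i s b)) p x-cyc | firstHit s b q eq | firstHit s b′ q′ eq′
  ... | k , onCycle , first | j , hit | j′ , hit′ = go (ℕ.<-cmp k j)
    where
    start-not-onCycle : ∀ {c} → Start c → ¬ OnCycle s c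
    start-not-onCycle {c} st oc = proj₂ oc c st ε
    positive : ∀ {m c} → Start c → OnCycle s (iter m s c) → 0 < m
    positive {zero} st oc = ⊥-elim (start-not-onCycle st oc)
    positive {suc m} _ _ = z<s
    0<j : ∀ {j} → iter j s b ≡ b′ → 0 < j
    0<j {zero} eq = ⊥-elim (b≢b′ eq)
    0<j {suc j} _ = z<s
    go : _ → CycleBefore st st′ s ⊎ CycleBefore st′ st s
    go (tri< k<j _ _) = inj₁ record
      { a = iter k s b ; onCycle = onCycle ; first = first
      ; ord = record { k = k ; j = j ; 0<k = positive {k} st onCycle ; k<j = k<j ; a-at = refl ; b′-at = hit } }
    go (tri≈ _ refl _) = ⊥-elim (start-not-onCycle st′ (subst (OnCycle s) (proj₁ hit) onCycle))
    go (tri> _ _ j<k) = inj₂ record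
      { a = iter k s b ; onCycle = onCycle
      ; first = λ {i} i<k′ oc → first (subst (i + j <_) (ℕ.m∸n+n≡m (ℕ.<⇒≤ j<k)) (ℕ.+-monoˡ-< j i<k′)) (subst (OnCycle s) (shift i) oc)
      ; ord = record { k = k ∸ j ; j = j′ ; 0<k = ℕ.m<n⇒0<n∸m j<k ; k<j = k′<j′
                     ; a-at = trans (shift (k ∸ j)) (cong (λ m → iter m s b) (ℕ.m∸n+n≡m (ℕ.<⇒≤ j<k)))
                     ; b′-at = hit′ } }
      where
      shift : ∀ i → iter i s b′ ≡ iter (i + j) s b
      shift i = trans (cong (iter i s) (sym (proj₁ hit))) (sym (iter-+ i j s b))
      k′<j′ : k ∸ j < j′
      k′<j′ with ℕ.≤-<-connex j′ (k ∸ j)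
      ... | inj₂ lt = lt
      -- Otherwise `b` would recur at position `j′ + j`, no later than `k`, although the positions
      -- up to the first cycle element are distinct.
      ... | inj₁ j′≤ = ⊥-elim (distinct {x = iter k s b} {j = k} (refl , λ i<k eq → first i<k (subst (OnCycle s) (sym eq) onCycle))
              {0} {j′ + j} (ℕ.≤-trans (0<j (proj₁ hit)) (ℕ.m≤n+m j j′))
              (subst (j′ + j ≤_) (ℕ.m∸n+n≡m (ℕ.<⇒≤ j<k)) (ℕ.+-monoˡ-≤ j j′≤))
              (trans (sym (proj₁ hit′)) (shift j′)))

-- Counting permutations coded as vectors.

module _ {N : ℕ} where

  ∈-allVecs : ∀ {k} (v : Vec (Fin N) k) → v ∈ allVecs k
  ∈-allVecs []      = here refl
  ∈-allVecs (x ∷ v) = ∈-concatMap⁺ (λ x → map (x ∷_) (allVecs _)) (lose (∈-allFin x) (∈-map⁺ (x ∷_) (∈-allVecs v)))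

  allVecs-unique : ∀ k → Unique (allVecs {N} k)
  allVecs-unique zero    = [] ∷ []
  allVecs-unique (suc k) = go (Unique.allFin⁺ N)
    where
    extend : Fin N → List (Vec (Fin N) (suc k))
    extend x = map (x ∷_) (allVecs k)
    go : ∀ {xs} → Unique xs → Unique (concatMap extend xs)
    go [] = []
    go {x ∷ xs} (x∉ ∷ uniq) = Unique.++⁺ (Unique.map⁺ Vec.∷-injectiveʳ (allVecs-unique k)) (go uniq)
        λ { (p , q) → disjoint (∈-map⁻ (x ∷_) p) (find (∈-concatMap⁻ extend q)) }
      where
      disjoint : ∀ {v} → (∃ λ u → u ∈ allVecs k × v ≡ x ∷ u) → ¬ (∃ λ y → y ∈ xs × v ∈ extend y)
      disjoint (_ , _ , refl) (y , y∈ , v∈) with ∈-map⁻ (y ∷_) v∈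
      ... | _ , _ , refl = All.lookup x∉ y∈ refl

  lookup-injective : ∀ {k} {v w : Vec (Fin N) k} → (∀ u → lookup v u ≡ lookup w u) → v ≡ w
  lookup-injective {v = v} {w} eq =
    trans (sym (Vec.tabulate∘lookup v)) (trans (Vec.tabulate-cong eq) (Vec.tabulate∘lookup w))

module _ {N : ℕ} {A B : Subset N} {d : Fin N → Fin N} (bij : IsBijection B A d) where
  open Bijection bij

  inW : ℕ → Vec (Fin N) N → Bool
  inW k v = isCyclicOn A (lookup v) ∧ (components (lookup v) ≡ᵇ k)

  W-list : ℕ → List (Vec (Fin N) N)
  W-list k = filterᵇ (inW k) (allVecs N)

  W-list-unique : ∀ k → Unique (W-list k)
  W-list-unique k = Unique.filter⁺ (T? ∘ inW k) (allVecs-unique N)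

  ∈-W-list⁻ : ∀ {k v} → v ∈ W-list k → CyclicOn A (lookup v) × components (lookup v) ≡ k
  ∈-W-list⁻ {k} {v} v∈ with ∧⁻ {isCyclicOn A (lookup v)} (proj₂ (∈-filter⁻ (T? ∘ inW k) {xs = allVecs N} v∈))
  ... | c , eq = isCyclicOn⇒CyclicOn c , ℕ.≡ᵇ⇒≡ _ _ eq

  ∈-W-list⁺ : ∀ {k v} → CyclicOn A (lookup v) → components (lookup v) ≡ k → v ∈ W-list k
  ∈-W-list⁺ {k} {v} cyc eq = ∈-filter⁺ (T? ∘ inW k) (∈-allVecs v)
    (∧⁺ (CyclicOn⇒isCyclicOn cyc) (ℕ.≡⇒≡ᵇ _ _ eq))

  module _ {b b′ : Fin N} (st : Start b) (st′ : Start b′) where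

    Exchanges : Vec (Fin N) N → Vec (Fin N) N → Set
    Exchanges v v′ = Σ (CycleBefore st st′ (lookup v)) λ cb → Exchange b (CycleBefore.a cb) b′ (lookup v) (lookup v′)

    exchange-exists : ∀ {k v} → v ∈ W-list k → CycleBefore st st′ (lookup v)
      → ∃ λ v′ → v′ ∈ W-list (k ∸ 1) × Exchanges v v′
    exchange-exists {k} {v} v∈ cb =
        -- By `components-drop` the count of `v` is a successor, so the truncated subtraction is
        -- exact.
        v′ , ∈-W-list⁺ X.cyclic (cong (_∸ 1) (trans (sym X.components-drop) (proj₂ (∈-W-list⁻ v∈)))) , cb , v′≗
      where
      s′ : Fin N → Fin N
      s′ u = lookup v (transpose (CycleBefore.a cb) b′ (transpose b b′ u))
      v′ : Vec (Fin N) N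
      v′ = tabulate s′
      v′≗ : ∀ u → lookup v′ u ≡ s′ u
      v′≗ = Vec.lookup∘tabulate s′
      module X = Exchanged st st′ (proj₁ (∈-W-list⁻ v∈)) cb v′≗

    exchanges-injective : ∀ {k v w v′} → (∀ {s} → components s ≡ k → Maximal s)
      → v ∈ W-list k → w ∈ W-list k → Exchanges v v′ → Exchanges w v′ → v ≡ w
    exchanges-injective {v = v} {w} maximal v∈ w∈ (cb , e) (cb′ , e′) =
      let cyc , eq = ∈-W-list⁻ v∈ ; cyc′ , eq′ = ∈-W-list⁻ w∈
      in lookup-injective {v = v} {w} (exchange-injective st st′ cyc cyc′ (maximal eq) (maximal eq′) cb cb′ e e′)

  module _ {b b′ : Fin N} (st : Start b) (st′ : Start b′) (b≢b′ : b ≢ b′)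
           {k : ℕ} (maximal : ∀ {s} → components s ≡ k → Maximal s) (starts<k : length starts < k) where

    -- Two tagged copies, one for each of the two starts in the role of `b`; they account for the
    -- factor 2.
    targets : List (Vec (Fin N) N ⊎ Vec (Fin N) N)
    targets = map inj₁ (W-list (k ∸ 1)) ++ map inj₂ (W-list (k ∸ 1))

    length-targets : length targets ≡ 2 * length (W-list (k ∸ 1))
    length-targets = trans (List.length-++ (map inj₁ (W-list (k ∸ 1))))
      (cong₂ _+_ (List.length-map inj₁ (W-list (k ∸ 1)))
                 (trans (List.length-map inj₂ (W-list (k ∸ 1))) (sym (ℕ.+-identityʳ (length (W-list (k ∸ 1)))))))

    ExchangesTo : Vec (Fin N) N → Vec (Fin N) N ⊎ Vec (Fin N) N → Set
    ExchangesTo v (inj₁ v′) = Exchanges st st′ v v′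
    ExchangesTo v (inj₂ v′) = Exchanges st′ st v v′

    W-halving : length (W-list k) ≤ 2 * length (W-list (k ∸ 1))
    W-halving = ℕ.≤-trans (relation⇒length≤ ExchangesTo {xs = W-list k} {ys = targets} (W-list-unique k) total inj)
                          (ℕ.≤-reflexive length-targets)
      where
      target : ∀ {v} → v ∈ W-list k → CycleBefore st st′ (lookup v) ⊎ CycleBefore st′ st (lookup v)
        → ∃ λ t → t ∈ targets × ExchangesTo v t
      target {v} v∈ (inj₁ cb) = let v′ , v′∈ , r = exchange-exists st st′ {v = v} v∈ cb
        in inj₁ v′ , ∈-++⁺ˡ (∈-map⁺ inj₁ v′∈) , r
      target {v} v∈ (inj₂ cb) = let v′ , v′∈ , r = exchange-exists st′ st {v = v} v∈ cb
        in inj₂ v′ , ∈-++⁺ʳ (map inj₁ (W-list (k ∸ 1))) (∈-map⁺ inj₂ v′∈) , r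
      total : ∀ {v} → v ∈ W-list k → ∃ λ t → t ∈ targets × ExchangesTo v t
      total {v} v∈ = let cyc , eq = ∈-W-list⁻ v∈ in
        target v∈ (cycle-before cyc (cycle-exists (lookup v) (subst (length starts <_) (sym eq) starts<k)) st st′ b≢b′)
      inj : ∀ {v w t} → v ∈ W-list k → w ∈ W-list k → ExchangesTo v t → ExchangesTo w t → v ≡ w
      inj {t = inj₁ v′} = exchanges-injective st st′ {v′ = v′} maximal
      inj {t = inj₂ v′} = exchanges-injective st′ st {v′ = v′} maximal

  W-bound : 2 ≤ length pathReps → length pathReps < ∣ A ∣ ∸ length cycleReps
    → W A B d (∣ A ∣ ∸ length cycleReps) ≤ 2 * W A B d (∣ A ∣ ∸ length cycleReps ∸ 1)
  W-bound 2≤p p<k =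
    let b , b′ , st , st′ , b≢b′ = two-starts 2≤p
    in W-halving st st′ b≢b′
         -- Maximality: `components-bound` limits every cyclic permutation to the value `k` chosen
         -- here, namely `∣ A ∣ ∸ length cycleReps`.
         (λ { eq {s′} cyc → subst (components s′ ≤_) (sym eq)
                              (ℕ.m+n≤o⇒m≤o∸n (components s′) (components-bound cyc st)) })
         (ℕ.≤-<-trans starts≤paths p<k)

-- Passing to the component-type.

inequality : ∀ (N n : ℕ) (A B : Subset N) (d : Fin N → Fin N) (la mu : List ℕ)
    → ∣ A ∣ ≡ n → ∣ B ∣ ≡ n → IsBijection B A d → ComponentType A B d la mu
    → 2 ≤ length la → length la < n ∸ length mu
    → W A B d (n ∸ length mu) ≤ 2 * W A B d (n ∸ length mu ∸ 1)
inequality N .(∣ A ∣) A B d la mu refl _ bij (paths , cycles) 2≤ lt =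
    subst (λ m → W A B d (∣ A ∣ ∸ m) ≤ 2 * W A B d (∣ A ∣ ∸ m ∸ 1)) m≡
      (W-bound bij (subst (2 ≤_) (sym p≡) 2≤) (subst₂ (λ p m → p < ∣ A ∣ ∸ m) (sym p≡) (sym m≡) lt))
  where
  open Bijection bij
  p≡ : length pathReps ≡ length la
  p≡ = trans (sym (List.length-map _ pathReps)) (↭-length paths)
  m≡ : length cycleReps ≡ length mu
  m≡ = trans (sym (List.length-map _ cycleReps)) (↭-length cycles)

-- An example with equality.

A₀ B₀ : Subset 6
A₀ = outside ∷ outside ∷ inside ∷ inside ∷ inside ∷ inside ∷ []
B₀ = inside ∷ inside ∷ inside ∷ inside ∷ outside ∷ outside ∷ []

-- λ = (1 , 1) and μ = (2).  The two last values are irrelevant.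
d₀ : Fin 6 → Fin 6
d₀ = lookup (# 4 ∷ # 5 ∷ # 3 ∷ # 2 ∷ # 0 ∷ # 0 ∷ [])

d₀-bijection : IsBijection B₀ A₀ d₀
d₀-bijection = from-yes
  (     Fin.all? (λ x → x ∈? B₀ →-dec d₀ x ∈? A₀)
  ×-dec Fin.all? (λ x → Fin.all? λ y → x ∈? B₀ →-dec y ∈? B₀ →-dec d₀ x ≟ d₀ y →-dec x ≟ y)
  ×-dec Fin.all? (λ y → y ∈? A₀ →-dec Fin.any? (λ x → x ∈? B₀ ×-dec d₀ x ≟ y)))

-- Of the six 4-cycles on `A₀`, four take 2 to 3 or 3 to 2, which gives f one fixed point besides
-- its two paths. The other two give only the two paths, so the counts are 4 and 2.
d₀-sharp : W A₀ B₀ d₀ 3 ≡ 2 * W A₀ B₀ d₀ 2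
d₀-sharp = refl

theorem2 : (∀ (N n : ℕ) (A B : Subset N) (d : Fin N → Fin N) (la mu : List ℕ)
    → ∣ A ∣ ≡ n → ∣ B ∣ ≡ n → IsBijection B A d → ComponentType A B d la mu
    → 2 ≤ length la → length la < n ∸ length mu
    → W A B d (n ∸ length mu) ≤ 2 * W A B d (n ∸ length mu ∸ 1))
    × (∃ λ N → ∃ λ n → Σ (Subset N) λ A → Σ (Subset N) λ B → Σ (Fin N → Fin N) λ d → Σ (List ℕ) λ la → Σ (List ℕ) λ mu →
    ∣ A ∣ ≡ n × ∣ B ∣ ≡ n × IsBijection B A d × ComponentType A B d la mu
    × 2 ≤ length la × length la < n ∸ length mu
    × W A B d (n ∸ length mu) ≡ 2 * W A B d (n ∸ length mu ∸ 1))
theorem2 = inequality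
  , 6 , 4 , A₀ , B₀ , d₀ , 1 ∷ 1 ∷ [] , 2 ∷ []
  , refl , refl , d₀-bijection , (↭-refl , ↭-refl) , ℕ.≤-refl , ℕ.≤-refl , d₀-sharp
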